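{- (i) For any positive integers $v_1, v_2$, either $\mathrm{ML}(v_1,v_2)=\frac{s}{2s+1}$ for some $s\in\mathbb{N}$, or $\mathrm{ML}(v_1,v_2)=\frac12$. (ii) For any positive integers $v_1,v_2,v_3$, either $\mathrm{ML}(v_1,v_2,v_3)=\frac{s}{3s+1}$ for some $s\in\mathbb{N}$, or $\mathrm{ML}(v_1,v_2,v_3)\ge \frac13$.
   Context: For a real number $x$, $\Vert x\Vert$ denotes the distance from $x$ to the nearest integer. For positive integers $v_1,\ldots,v_n$, the maximum loneliness is $\mathrm{ML}(v_1,\ldots,v_n)=\max_{t\in\mathbb{R}}\min_{1\le i\le n}\Vert t v_i\Vert$. Here $\mathbb{N}=\{1,2,3,\ldots\}$. -}

module Defs where

open import Data.Bool using (true; false)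
open import Data.Integer as ℤ using (ℤ; +_)
import Data.Integer.DivMod as ℤ
import Data.Integer.Properties as ℤ
open import Data.Nat as ℕ using (ℕ; suc)
import Data.Nat.Coprimality as Coprime
import Data.Nat.Properties as ℕ
open import Data.Product using (_×_; _,_; ∃-syntax)
open import Data.Rational
open import Data.Rational.Properties
open import Data.Rational.Solver using (module +-*-Solver)
open import Data.Sum using (inj₁; inj₂)
open import Data.Vec using (Vec; foldr₁; map)
open import Relation.Binary.Definitions using (tri<; tri≈; tri>)
open import Relation.Binary.PropositionalEquality
open +-*-Solver using (solve; _:+_; _:-_; _:*_; :-_; _:=_; con)

private
  fromℤ : ℤ → ℚ
  fromℤ k = mkℚ k 0 (Coprime.sym (Coprime.1-coprimeTo ℤ.∣ k ∣))

  /1≡fromℤ : ∀ k → k / 1 ≡ fromℤ k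
  /1≡fromℤ k = ↥p/↧p≡p (fromℤ k)

  /1-mono-≤ : ∀ {i j} → i ℤ.≤ j → i / 1 ≤ j / 1
  /1-mono-≤ {i} {j} i≤j rewrite /1≡fromℤ i | /1≡fromℤ j =
    *≤* (ℤ.*-monoʳ-≤-nonNeg (+ 1) i≤j)

  suc-/1 : ∀ i → ℤ.suc i / 1 ≡ i / 1 + 1ℚ
  suc-/1 i rewrite /1≡fromℤ i | /1≡fromℤ (ℤ.suc i) =
    trans (sym (/1≡fromℤ (ℤ.suc i)))
          (cong (_/ 1) (trans (ℤ.+-comm (+ 1) i) (cong (ℤ._+ + 1) (sym (ℤ.*-identityʳ i)))))

  neg-/1 : ∀ i → (ℤ.- i) / 1 ≡ - (i / 1)
  neg-/1 i rewrite /1≡fromℤ i | /1≡fromℤ (ℤ.- i) with i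
  ... | + 0       = refl
  ... | ℤ.+[1+ _ ] = refl
  ... | ℤ.-[1+ _ ] = refl

  floor-≤ : ∀ p → floor p / 1 ≤ p
  floor-≤ p@record{} rewrite /1≡fromℤ (floor p) =
    *≤* (subst (floor p ℤ.* ↧ p ℤ.≤_) (sym (ℤ.*-identityʳ (↥ p))) (ℤ.[n/d]*d≤n (↥ p) (↧ p)))

  ≤-suc-floor : ∀ p → p ≤ floor p / 1 + 1ℚ
  ≤-suc-floor p@record{} rewrite sym (suc-/1 (floor p)) | /1≡fromℤ (ℤ.suc (floor p)) =
    *≤* (subst₂ ℤ._≤_ (sym (ℤ.*-identityʳ (↥ p)))
          (cong (λ z → ℤ.suc z ℤ.* ↧ p) (sym (ℤ.div-pos-is-/ℕ (↥ p) (↧ₙ p))))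
          (ℤ.<⇒≤ (ℤ.n<s[n/ℕd]*d (↥ p) (↧ₙ p))))

  shift : ∀ {a b c d} → a ≤ b → b - a ≡ d - c → c ≤ d
  shift a≤b eq = 0≤q-p⇒p≤q (subst (0ℚ ≤_) eq (p≤q⇒0≤q-p a≤b))
    where
    p≤q⇒0≤q-p : ∀ {p q} → p ≤ q → 0ℚ ≤ q - p
    p≤q⇒0≤q-p {p} {q} p≤q = subst (_≤ q - p) (+-inverseʳ p) (+-monoˡ-≤ (- p) p≤q)
    0≤q-p⇒p≤q : ∀ {p q} → 0ℚ ≤ q - p → p ≤ q
    0≤q-p⇒p≤q {p} {q} h = subst₂ _≤_ (+-identityˡ p)
      (solve 2 (λ p q → (q :- p) :+ p := q) refl p q) (+-monoˡ-≤ p h)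

  ∣∣-≤ : ∀ {p ε} → p ≤ ε → - p ≤ ε → ∣ p ∣ ≤ ε
  ∣∣-≤ {p} p≤ε -p≤ε with ∣p∣≡p∨∣p∣≡-p p
  ... | inj₁ eq = subst (_≤ _) (sym eq) p≤ε
  ... | inj₂ eq = subst (_≤ _) (sym eq) -p≤ε

  p≤∣p∣ : ∀ p → p ≤ ∣ p ∣
  p≤∣p∣ p with ≤-total 0ℚ p
  ... | inj₁ 0≤p = ≤-reflexive (sym (0≤p⇒∣p∣≡p 0≤p))
  ... | inj₂ p≤0 = ≤-trans p≤0 (0≤∣p∣ p)

  ∣-∣-comm : ∀ p q → ∣ p - q ∣ ≡ ∣ q - p ∣
  ∣-∣-comm p q = trans (sym (∣-p∣≡∣p∣ (p - q)))
    (cong ∣_∣ (solve 2 (λ p q → :- (p :- q) := q :- p) refl p q))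

  floor-half : ∀ p → ∣ p - floor (p + ½) / 1 ∣ ≤ ½
  floor-half p = ∣∣-≤
    (shift (≤-suc-floor (p + ½))
      (solve 2 (λ p f → (f :+ con 1ℚ) :- (p :+ con ½) := con ½ :- (p :- f)) refl p f))
    (shift (floor-≤ (p + ½))
      (solve 2 (λ p f → (p :+ con ½) :- f := con ½ :- (:- (p :- f))) refl p f))
    where f = floor (p + ½) / 1

  ceiling≡-floor- : ∀ p → ceiling p ≡ ℤ.- floor (- p)
  ceiling≡-floor- record{} = refl

  ceiling-half : ∀ p → ∣ p - ceiling (p - ½) / 1 ∣ ≤ ½
  ceiling-half p = subst (_≤ ½) eq (floor-half (- p))
    where
    f = floor (- p + ½)
    -[p-½] : - (p - ½) ≡ - p + ½
    -[p-½] = solve 1 (λ p → :- (p :- con ½) := :- p :+ con ½) refl p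
    ceil : ceiling (p - ½) / 1 ≡ - (f / 1)
    ceil = trans (cong (_/ 1) (trans (ceiling≡-floor- (p - ½)) (cong (λ z → ℤ.- floor z) -[p-½])))
                 (neg-/1 f)
    eq : ∣ - p - f / 1 ∣ ≡ ∣ p - ceiling (p - ½) / 1 ∣
    eq = trans (sym (∣-p∣≡∣p∣ (- p - f / 1))) (cong ∣_∣ (trans
      (solve 2 (λ p f → :- (:- p :- f) := p :- (:- f)) refl p (f / 1))
      (cong (λ z → p - z) (sym ceil))))

  round-half : ∀ p → ∣ p - round p / 1 ∣ ≤ ½
  round-half p with p ≤ᵇ 0ℚ
  ... | true  = ceiling-half p
  ... | false = floor-half p

‖_‖ℚ : ℚ → ℚ
‖ q ‖ℚ = ∣ q - round q / 1 ∣

‖‖ℚ-nearest : ∀ q k → ‖ q ‖ℚ ≤ ∣ q - k / 1 ∣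
‖‖ℚ-nearest q k with ℤ.<-cmp k (round q)
... | tri≈ _ refl _ = ≤-refl
... | tri< k<r _ _ = ≤-trans (round-half q) (≤-trans
  (shift (+-mono-≤ gap (≤-trans (p≤∣p∣ (- (q - r))) (subst (_≤ ½) (sym (∣-p∣≡∣p∣ (q - r))) (round-half q))))
    (solve 3 (λ q r k → (r :+ con ½) :- ((k :+ con 1ℚ) :+ (:- (q :- r))) := (q :- k) :- con ½) refl q r (k / 1)))
  (p≤∣p∣ (q - k / 1)))
  where
  r = round q / 1
  gap : k / 1 + 1ℚ ≤ r
  gap = subst (_≤ r) (suc-/1 k) (/1-mono-≤ (ℤ.i<j⇒suc[i]≤j k<r))
... | tri> _ _ r<k = ≤-trans (round-half q) (≤-trans
  (shift (+-mono-≤ gap (≤-trans (p≤∣p∣ (q - r)) (round-half q)))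
    (solve 3 (λ q r k → (k :+ con ½) :- ((r :+ con 1ℚ) :+ (q :- r)) := (:- (q :- k)) :- con ½) refl q r (k / 1)))
  (subst (- (q - k / 1) ≤_) (∣-p∣≡∣p∣ (q - k / 1)) (p≤∣p∣ (- (q - k / 1)))))
  where
  r = round q / 1
  gap : r + 1ℚ ≤ k / 1
  gap = subst (_≤ k / 1) (suc-/1 (round q)) (/1-mono-≤ (ℤ.i<j⇒suc[i]≤j r<k))

private
  ‖‖ℚ-triangle : ∀ p q → ‖ p ‖ℚ - ‖ q ‖ℚ ≤ ∣ p - q ∣
  ‖‖ℚ-triangle p q = shift
    (≤-trans (‖‖ℚ-nearest p (round q)) (subst (λ z → ∣ z ∣ ≤ ∣ p - q ∣ + ‖ q ‖ℚ)
      (solve 3 (λ p q r → (p :- q) :+ (q :- r) := p :- r) refl p q (round q / 1))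
      (∣p+q∣≤∣p∣+∣q∣ (p - q) (q - round q / 1))))
    (solve 3 (λ a b c → (c :+ b) :- a := c :- (a :- b)) refl ‖ p ‖ℚ ‖ q ‖ℚ ∣ p - q ∣)

‖‖ℚ-lipschitz : ∀ p q → ∣ ‖ p ‖ℚ - ‖ q ‖ℚ ∣ ≤ ∣ p - q ∣
‖‖ℚ-lipschitz p q = ∣∣-≤ (‖‖ℚ-triangle p q)
  (subst₂ _≤_ (solve 2 (λ a b → b :- a := :- (a :- b)) refl ‖ p ‖ℚ ‖ q ‖ℚ) (∣-∣-comm q p)
    (‖‖ℚ-triangle q p))

private
  ⊓-upper : ∀ {a b c d ε} → ∣ a - c ∣ ≤ ε → ∣ b - d ∣ ≤ ε → a ⊓ b - c ⊓ d ≤ ε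
  ⊓-upper {a} {b} {c} {d} {ε} ac bd with ⊓-sel c d
  ... | inj₁ eq rewrite eq = ≤-trans (+-monoˡ-≤ (- c) (p⊓q≤p a b)) (≤-trans (p≤∣p∣ (a - c)) ac)
  ... | inj₂ eq rewrite eq = ≤-trans (+-monoˡ-≤ (- d) (p⊓q≤q a b)) (≤-trans (p≤∣p∣ (b - d)) bd)

  ⊓-close : ∀ {a b c d ε} → ∣ a - c ∣ ≤ ε → ∣ b - d ∣ ≤ ε → ∣ a ⊓ b - c ⊓ d ∣ ≤ ε
  ⊓-close {a} {b} {c} {d} {ε} ac bd = ∣∣-≤ (⊓-upper {a} {b} {c} {d} ac bd)
    (subst (_≤ ε) (solve 2 (λ x y → y :- x := :- (x :- y)) refl (a ⊓ b) (c ⊓ d))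
      (⊓-upper {c} {d} {a} {b} (subst (_≤ ε) (∣-∣-comm a c) ac) (subst (_≤ ε) (∣-∣-comm b d) bd)))

-- Cauchy reals.  The existential in `cauchy` carries a modulus of convergence.
record ℝ : Set where
  field
    seq    : ℕ → ℚ
    cauchy : ∀ ε → 0ℚ < ε →
             ∃[ N ] (∀ m n → N ℕ.≤ m → N ℕ.≤ n → ∣ seq m - seq n ∣ ≤ ε)

open ℝ public

infix 4 _≃ᴿ_ _≤ᴿ_

_≃ᴿ_ : ℝ → ℝ → Set
x ≃ᴿ y = ∀ ε → 0ℚ < ε → ∃[ N ] (∀ n → N ℕ.≤ n → ∣ seq x n - seq y n ∣ ≤ ε)

_≤ᴿ_ : ℝ → ℝ → Set
x ≤ᴿ y = ∀ ε → 0ℚ < ε → ∃[ N ] (∀ n → N ℕ.≤ n → seq x n ≤ seq y n + ε)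

fromℚ : ℚ → ℝ
fromℚ q .seq _ = q
fromℚ q .cauchy ε 0<ε = 0 , λ _ _ _ _ →
  subst (λ z → ∣ z ∣ ≤ ε) (sym (+-inverseʳ q)) (<⇒≤ 0<ε)

infixl 7 _·_
infixl 7 _⊓ᴿ_

private
  scale : ∀ v (x : ℝ) ε → 0ℚ < ε →
          ∃[ N ] (∀ m n → N ℕ.≤ m → N ℕ.≤ n → ∣ + v / 1 * seq x m - + v / 1 * seq x n ∣ ≤ ε)
  scale 0 x ε 0<ε = 0 , λ m n _ _ →
    subst (λ z → ∣ z ∣ ≤ ε) (solve 2 (λ a b → con 0ℚ := con 0ℚ :* a :- con 0ℚ :* b) refl (seq x m) (seq x n)) (<⇒≤ 0<ε)
  scale (suc v) x ε 0<ε with cauchy x (ε * w) 0<εw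
    where
    w = + 1 / suc v
    0<εw : 0ℚ < ε * w
    0<εw = positive⁻¹ (ε * w) {{pos*pos⇒pos ε {{positive 0<ε}} w {{normalize-pos 1 (suc v)}}}}
  ... | N , close = N , λ m n N≤m N≤n → subst₂ _≤_
      (sym (trans (cong ∣_∣ (solve 3 (λ c a b → c :* a :- c :* b := c :* (a :- b)) refl c (seq x m) (seq x n)))
        (trans (∣p*q∣≡∣p∣*∣q∣ c (seq x m - seq x n)) (cong (_* ∣ seq x m - seq x n ∣) ∣c∣))))
      (trans (solve 3 (λ c e w → c :* (e :* w) := e :* (c :* w)) refl c ε (+ 1 / suc v))
        (trans (cong (ε *_) cw) (*-identityʳ ε)))
      (*-monoˡ-≤-nonNeg c {{pos⇒nonNeg c {{normalize-pos (suc v) 1}}}} (close m n N≤m N≤n))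
    where
    c = + suc v / 1
    ∣c∣ : ∣ c ∣ ≡ c
    ∣c∣ = 0≤p⇒∣p∣≡p (nonNegative⁻¹ c {{pos⇒nonNeg c {{normalize-pos (suc v) 1}}}})
    w≡ : + 1 / suc v ≡ 1/ fromℤ (+ suc v)
    w≡ = ↥p/↧p≡p (1/ fromℤ (+ suc v))
    cw : c * (+ 1 / suc v) ≡ 1ℚ
    cw = trans (cong₂ _*_ (/1≡fromℤ (+ suc v)) w≡) (*-inverseʳ (fromℤ (+ suc v)))

_·_ : ℕ → ℝ → ℝ
(v · x) .seq n = + v / 1 * seq x n
(v · x) .cauchy = scale v x

_⊓ᴿ_ : ℝ → ℝ → ℝ
(x ⊓ᴿ y) .seq n = seq x n ⊓ seq y n
(x ⊓ᴿ y) .cauchy ε 0<ε with cauchy x ε 0<ε | cauchy y ε 0<ε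
... | M , closeˣ | N , closeʸ = M ℕ.⊔ N , λ m n ≤m ≤n →
  ⊓-close {seq x m} {seq y m} {seq x n} {seq y n}
    (closeˣ m n (ℕ.m⊔n≤o⇒m≤o M N ≤m) (ℕ.m⊔n≤o⇒m≤o M N ≤n))
    (closeʸ m n (ℕ.m⊔n≤o⇒n≤o M N ≤m) (ℕ.m⊔n≤o⇒n≤o M N ≤n))

-- The continuous extension to ℝ of the 1-Lipschitz map ‖_‖ℚ; rounding itself is
-- not continuous, so it is not available on ℝ.
‖_‖ : ℝ → ℝ
‖ x ‖ .seq n = ‖ seq x n ‖ℚ
‖ x ‖ .cauchy ε 0<ε with cauchy x ε 0<ε
... | N , close = N , λ m n N≤m N≤n →
  ≤-trans (‖‖ℚ-lipschitz (seq x m) (seq x n)) (close m n N≤m N≤n)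

loneliness : ∀ {n} → Vec ℕ (suc n) → ℝ → ℝ
loneliness vs t = foldr₁ _⊓ᴿ_ (map (λ v → ‖ v · t ‖) vs)

IsMaximum : (ℝ → ℝ) → ℝ → Set
IsMaximum f m = (∃[ t ] f t ≃ᴿ m) × (∀ t → f t ≤ᴿ m)

-- IsML vs m reads "ML(vs) = m".
IsML : ∀ {n} → Vec ℕ (suc n) → ℝ → Set
IsML vs = IsMaximum (loneliness vs)

private
  half : ∀ ε → 0ℚ < ε → ∃[ δ ] (0ℚ < δ × δ + δ ≡ ε)
  half ε 0<ε = ½ * ε , positive⁻¹ (½ * ε) {{pos*pos⇒pos ½ ε {{positive 0<ε}}}} ,
    trans (sym (*-distribʳ-+ ε ½ ½)) (*-identityˡ ε)

  ≤-chain : ∀ {a b c δ} → ∣ a - b ∣ ≤ δ → a ≤ c + δ → b ≤ c + (δ + δ)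
  ≤-chain {a} {b} {c} {δ} ab ac =
    shift (+-mono-≤ (≤-trans (p≤∣p∣ (b - a)) (subst (_≤ δ) (∣-∣-comm a b) ab)) ac)
      (solve 4 (λ a b c d → (d :+ (c :+ d)) :- ((b :- a) :+ a) := (c :+ (d :+ d)) :- b) refl a b c δ)

  ≤-antisym-close : ∀ {b c ε} → b ≤ c + ε → c ≤ b + ε → ∣ b - c ∣ ≤ ε
  ≤-antisym-close {b} {c} {ε} b≤ c≤ = ∣∣-≤
    (shift b≤ (solve 3 (λ b c e → (c :+ e) :- b := e :- (b :- c)) refl b c ε))
    (shift c≤ (solve 3 (λ b c e → (b :+ e) :- c := e :- (:- (b :- c))) refl b c ε))

  max-≤ : ∀ {f m m′} → IsMaximum f m → IsMaximum f m′ → m ≤ᴿ m′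
  max-≤ {f} {m} {m′} ((t , ft≃m) , _) (_ , ub) ε 0<ε with half ε 0<ε
  ... | δ , 0<δ , refl with ft≃m δ 0<δ | ub t δ 0<δ
  ... | M , close | N , below = M ℕ.⊔ N , λ n ≤n →
    ≤-chain {seq (f t) n} {seq m n} {seq m′ n}
      (close n (ℕ.m⊔n≤o⇒m≤o M N ≤n)) (below n (ℕ.m⊔n≤o⇒n≤o M N ≤n))

IsMaximum-unique : ∀ {f m m′} → IsMaximum f m → IsMaximum f m′ → m ≃ᴿ m′
IsMaximum-unique {f} {m} {m′} p q ε 0<ε
  with max-≤ {f} {m} {m′} p q ε 0<ε | max-≤ {f} {m′} {m} q p ε 0<ε
... | M , m≤m′ | N , m′≤m = M ℕ.⊔ N , λ n ≤n →
  ≤-antisym-close {seq m n} {seq m′ n}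
    (m≤m′ n (ℕ.m⊔n≤o⇒m≤o M N ≤n)) (m′≤m n (ℕ.m⊔n≤o⇒n≤o M N ≤n))

{-# OPTIONS --safe #-}

-- Only rational times t = p/D matter, since loneliness is computed pointwise on the approximants of
-- a real; so everything reduces to integer inequalities kD + m ≤ vp ≤ (k + 1)D − m.
--
-- (i) For coprime u, v with sum N, the floors k, l of ut, vt give Nρ ≤ (l + 1)u − kv and
-- Nρ ≤ (k + 1)v − lu for the loneliness ρ.  The two integers add up to N, so ρ ≤ ⌊N/2⌋/N, and this
-- is attained at the multiple of 1/N where u stands at ⌊N/2⌋/N.
--
-- (ii) Let the speeds have gcd 1.  If none is divisible by 3, take t = 1/3; if two are, start from a
-- time good for these two and shift it by a multiple of 1/3.  Otherwise, after changing signs, the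
-- speeds are a, a + 3e, 3c with 3 ∤ a and e ≥ 0.  At t = (u + i)/3 with i an integer, 3ct ≡ cu
-- mod 1 does not depend on i, and some i is good for both a and a + 3e as soon as au and (a + 3e)u
-- lie, mod 3, in a common interval [F, F + 1] with F an integer.  Such a u with ‖cu‖ ≥ 1/3 can be
-- written down unless c = e, when the speeds are x, y, x + y up to order and sign, or e = 1 and they
-- are 1, 2, 3c.  In these two families ML = s/(3s + 1) exactly, with 3s + 1 = x + 2y (arranging
-- x ≡ y + 1 mod 3) and s = c respectively.
--
-- The maximum exists because ρ can be increased until two runners u, v are equally far from
-- opposite ends of their laps, which happens at a multiple of 1/(u + v).
module Submission where

open import Defs

module Integral where

  open import Data.Empty using (⊥-elim)
  open import Data.Integer
  open import Data.Integer.DivMod using (a≡a%ℕn+[a/ℕn]*n; n%ℕd<d)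
  open import Data.Integer.Properties
  open import Data.Integer.Tactic.RingSolver using (solve)
  open import Data.List using (List; []; _∷_; map; cartesianProduct)
  import Data.List.Extrema
  open import Data.List.Membership.Propositional using (_∈_)
  open import Data.List.Membership.Propositional.Properties
    using (∈-cartesianProduct⁺; ∈-cartesianProduct⁻; ∈-map⁺)
  open import Data.List.Relation.Binary.Permutation.Propositional
    using (_↭_; prep; swap; ↭-refl; ↭-sym; ↭-trans)
  open import Data.List.Relation.Binary.Permutation.Propositional.Properties using (All-resp-↭)
  import Data.List.Relation.Binary.Pointwise as Pointwise
  open import Data.List.Relation.Binary.Pointwise using (Pointwise) renaming ([] to []ᴾ; _∷_ to _∷ᴾ_)
  import Data.List.Relation.Unary.All as All
  open import Data.List.Relation.Unary.All using (All) renaming ([] to []ᴬ; _∷_ to _∷ᴬ_)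
  open import Data.List.Relation.Unary.All.Properties using (map⁺; map⁻)
  open import Data.List.Relation.Unary.Any using (here)
  import Data.Nat as ℕ
  open import Data.Nat.Divisibility using (_∣_; divides)
  open import Data.Nat.GCD using (gcd; gcd[m,n]∣m; gcd[m,n]∣n; gcd-GCD; gcd[m,n]≢0; module Bézout)
  import Data.Nat.Properties as ℕ
  open import Data.Product using (_×_; _,_; ∃-syntax; proj₁; proj₂)
  open import Data.Rational.Unnormalised using (ℚᵘ; mkℚᵘ; *≤*)
  import Data.Rational.Unnormalised as ℚᵘ
  import Data.Rational.Unnormalised.Properties as ℚᵘ
  open import Data.Sum using (_⊎_; inj₁; inj₂)
  open import Function using (_∘_)
  open import Relation.Binary.Definitions using (Tri; tri<; tri≈; tri>)
  open import Relation.Binary.PropositionalEquality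
  open import Relation.Nullary using (¬_; contradiction; yes; no)
  open Data.List.Extrema ℚᵘ.≤-totalOrder using (argmin; argmin-all; f[argmin]≤f[xs])

  private
    variable
      D m p : ℤ
      vs ws : List ℤ

  -- Linear arithmetic by certificate: a goal is ≤-shift of a combination (⊕, ⊛, ⊙) of hypotheses with
  -- the same right-minus-left, which the ring solver checks.
  ≤-shift : ∀ {a b c d} → a ≤ b → b - a ≡ d - c → c ≤ d
  ≤-shift a≤b eq = 0≤i-j⇒j≤i (subst (0ℤ ≤_) eq (i≤j⇒0≤j-i a≤b))

  ≡-shift : ∀ {a b c d} → a ≡ b → a - b ≡ c - d → c ≡ d
  ≡-shift {a} {b} {c} {d} a≡b eq = i-j≡0⇒i≡j c d (trans (sym eq) (i≡j⇒i-j≡0 a≡b))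

  infixl 6 _⊕_
  _⊕_ : ∀ {a b c d} → a ≤ b → c ≤ d → a + c ≤ b + d
  _⊕_ = +-mono-≤

  infixr 7 _⊛_ _⊙_
  _⊛_ : ∀ {i a b} → 0ℤ ≤ i → a ≤ b → i * a ≤ i * b
  _⊛_ {i} 0≤i = *-monoˡ-≤-nonNeg i {{nonNegative 0≤i}}

  _⊙_ : ∀ {a b} i → a ≡ b → i * a ≤ i * b
  i ⊙ a≡b = ≤-reflexive (cong (i *_) a≡b)

  -- Loneliness at rational times as integer inequalities.

  -- For D > 0, the fraction x/D is at distance at least m/D from every integer.
  Clear : ℤ → ℤ → ℤ → Set
  Clear D m x = ∃[ k ] (k * D + m ≤ x × x + m ≤ (k + 1ℤ) * D)

  clear-neg : ∀ {x} → Clear D m x → Clear D m (- x)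
  clear-neg {D} {m} {x} (k , lo , hi) = - k - 1ℤ ,
    ≤-shift hi (solve (D ∷ m ∷ x ∷ k ∷ [])) ,
    ≤-shift lo (solve (D ∷ m ∷ x ∷ k ∷ []))

  Lonely : ℤ → ℤ → ℤ → List ℤ → Set
  Lonely D m p = All (λ v → Clear D m (v * p))

  -- The value s/N is reached at t = p/D.
  Attains : ℤ → ℤ → List ℤ → Set
  Attains N s vs = ∃[ D ] ∃[ m ] ∃[ p ] (0ℤ < D × s * D ≤ m * N × Lonely D m p vs)

  -- Only values m/D ≥ 0 are constrained: loneliness is never negative, and `double-bound` relies on
  -- the sign.
  Bounded : ℤ → ℤ → List ℤ → Set
  Bounded N s vs = ∀ {D m p} → 0ℤ < D → 0ℤ ≤ m → Lonely D m p vs → m * N ≤ s * D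

  -- Two speeds: the bound and its attainment.

  -- Weighting the inequality of each runner by the speed of the other makes the time `p` cancel.
  pair-bound : ∀ {u v k l} → 0ℤ ≤ u → 0ℤ ≤ v →
               k * D + m ≤ u * p → v * p + m ≤ (l + 1ℤ) * D →
               m * (u + v) ≤ ((l + 1ℤ) * u - k * v) * D
  pair-bound {D} {m} {p} {u} {v} {k} {l} 0≤u 0≤v lo hi =
    ≤-shift (0≤v ⊛ lo ⊕ 0≤u ⊛ hi) (solve (D ∷ m ∷ p ∷ u ∷ v ∷ k ∷ l ∷ []))

  ≤⊎suc≤ : ∀ i j → i ≤ j ⊎ j + 1ℤ ≤ i
  ≤⊎suc≤ i j with i ≤? j
  ... | yes i≤j = inj₁ i≤j
  ... | no  i≰j = inj₂ (subst (_≤ i) (+-comm 1ℤ j) (i<j⇒suc[i]≤j (≰⇒> i≰j)))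

  pair-bounded : ∀ {u v s} → 0ℤ ≤ u → 0ℤ ≤ v → u + v ≤ + 2 * s + 1ℤ → Bounded (u + v) s (u ∷ v ∷ [])
  pair-bounded {u} {v} {s} 0≤u 0≤v N≤ {D} {m} {p} 0<D _ ((k , lo , hi) ∷ᴬ (l , lo′ , hi′) ∷ᴬ []ᴬ) =
    go (≤⊎suc≤ ((l + 1ℤ) * u - k * v) s)
    where
    go : _ → m * (u + v) ≤ s * D
    go (inj₁ A≤s) = ≤-shift
      (pair-bound {D} {m} {p} {u} {v} {k} {l} 0≤u 0≤v lo hi′ ⊕ <⇒≤ 0<D ⊛ A≤s)
      (solve (D ∷ m ∷ u ∷ v ∷ k ∷ l ∷ s ∷ []))
    -- With the runners exchanged the integer is (k + 1)v - lu = u + v - A, which is now at most s.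
    go (inj₂ s<A) = ≤-shift
      (pair-bound {D} {m} {p} {v} {u} {l} {k} 0≤v 0≤u lo′ hi ⊕ <⇒≤ 0<D ⊛ s<A ⊕ <⇒≤ 0<D ⊛ N≤)
      (solve (D ∷ m ∷ u ∷ v ∷ k ∷ l ∷ s ∷ []))

  -- Modulo N = u + v one has v ≡ -u, so the Bézout relation says (α - β)u ≡ 1. Hence u stands at
  -- s/N and v at -s/N.
  pair-attains : ∀ {u v s α β} → 0ℤ < u + v → α * u + β * v ≡ 1ℤ → + 2 * s ≤ u + v →
                 Attains (u + v) s (u ∷ v ∷ [])
  pair-attains {u} {v} {s} {α} {β} 0<N bez 2s≤N =
    u + v , s , s * (α - β) , 0<N , ≤-refl ,
    (- (s * β) ,
      ≤-shift (s ⊙ sym bez) (solve (u ∷ v ∷ s ∷ α ∷ β ∷ [])) ,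
      ≤-shift (s ⊙ bez ⊕ 2s≤N) (solve (u ∷ v ∷ s ∷ α ∷ β ∷ []))) ∷ᴬ
    (s * α - 1ℤ ,
      ≤-shift (s ⊙ bez ⊕ 2s≤N) (solve (u ∷ v ∷ s ∷ α ∷ β ∷ [])) ,
      ≤-shift (s ⊙ sym bez) (solve (u ∷ v ∷ s ∷ α ∷ β ∷ []))) ∷ᴬ []ᴬ

  -- Division with remainder and residues modulo 3.

  euclid : ∀ x {D} → 0ℤ < D → ∃[ F ] ∃[ r ] (x ≡ F * D + r × 0ℤ ≤ r × r + 1ℤ ≤ D)
  euclid x {+0} (+<+ ())
  euclid x {+[1+ d ]} _ = F , r ,
    trans (a≡a%ℕn+[a/ℕn]*n x (ℕ.suc d)) (+-comm r (F * +[1+ d ])) ,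
    +≤+ ℕ.z≤n ,
    subst (_≤ +[1+ d ]) (+-comm 1ℤ r) (i<j⇒suc[i]≤j (+<+ (n%ℕd<d x (ℕ.suc d))))
    where
    F = x /ℕ ℕ.suc d
    r = + (x %ℕ ℕ.suc d)

  0≤1 : 0ℤ ≤ 1ℤ
  0≤1 = +≤+ ℕ.z≤n

  0<⇒1≤ : ∀ {i} → 0ℤ < i → 1ℤ ≤ i
  0<⇒1≤ 0<i = i<j⇒suc[i]≤j 0<i

  1≤⇒0< : ∀ {i} → 1ℤ ≤ i → 0ℤ < i
  1≤⇒0< 1≤i = suc[i]≤j⇒i<j 1≤i

  -- A step 3r of length at least L lies in [L, 2L] itself; a shorter one cannot jump over an
  -- interval of length L.
  landing : ∀ {r L} → 0ℤ < r → + 3 * r ≤ + 2 * L →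
            ∃[ k ] (L ≤ + 3 * k * r × + 3 * k * r ≤ + 2 * L)
  landing {r} {L} 0<r 3r≤2L = go (≤⊎suc≤ L (+ 3 * r))
    where
    Goal = ∃[ k ] (L ≤ + 3 * k * r × + 3 * k * r ≤ + 2 * L)
    step : + 3 * r + 1ℤ ≤ L →
           ∃[ F ] ∃[ ρ ] (L ≡ F * (+ 3 * r) + ρ × 0ℤ ≤ ρ × ρ + 1ℤ ≤ + 3 * r) → Goal
    step 3r<L (F , ρ , L≡ , 0≤ρ , ρ<3r) = F + 1ℤ ,
      ≤-shift (≤-reflexive L≡ ⊕ ρ<3r ⊕ 0≤1) (solve (r ∷ L ∷ F ∷ ρ ∷ [])) ,
      ≤-shift (≤-reflexive (sym L≡) ⊕ 0≤ρ ⊕ 3r<L ⊕ 0≤1) (solve (r ∷ L ∷ F ∷ ρ ∷ []))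
    go : _ → Goal
    go (inj₁ L≤3r) = 1ℤ , ≤-shift L≤3r (solve (r ∷ L ∷ [])) , ≤-shift 3r≤2L (solve (r ∷ L ∷ []))
    go (inj₂ 3r<L) = step 3r<L (euclid L (*-monoˡ-<-pos (+ 3) 0<r))

  Unit₃ : ℤ → Set
  Unit₃ a = (∃[ r ] a ≡ 1ℤ + + 3 * r) ⊎ (∃[ r ] a ≡ -1ℤ + + 3 * r)

  unit₃-square : ∀ {a} → Unit₃ a → ∃[ q ] a * a ≡ 1ℤ + + 3 * q
  unit₃-square (inj₁ (r , refl)) = + 2 * r + + 3 * r * r , solve (r ∷ [])
  unit₃-square (inj₂ (r , refl)) = + 3 * r * r - + 2 * r , solve (r ∷ [])

  unit₃-neg : ∀ {a} → Unit₃ a → Unit₃ (- a)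
  unit₃-neg (inj₁ (r , refl)) = inj₂ (- r , solve (r ∷ []))
  unit₃-neg (inj₂ (r , refl)) = inj₁ (- r , solve (r ∷ []))

  unit₃-shift : ∀ {a} k → Unit₃ a → Unit₃ (a + + 3 * k)
  unit₃-shift k (inj₁ (r , refl)) = inj₁ (r + k , solve (r ∷ k ∷ []))
  unit₃-shift k (inj₂ (r , refl)) = inj₂ (r + k , solve (r ∷ k ∷ []))

  3x≢1 : ∀ x → + 3 * x ≢ 1ℤ
  3x≢1 (+ ℕ.zero) ()
  3x≢1 (+[1+ n ]) eq = contradiction
    (subst (+ 3 * 1ℤ ≤_) eq (*-monoˡ-≤-nonNeg (+ 3) (+≤+ (ℕ.s≤s (ℕ.z≤n {n}))))) λ { (+≤+ (ℕ.s≤s ())) }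
  3x≢1 -[1+ n ] ()

  ¬unit₃-3* : ∀ x → ¬ Unit₃ (+ 3 * x)
  ¬unit₃-3* x (inj₁ (r , eq)) = 3x≢1 (x - r) (≡-shift eq (solve (x ∷ r ∷ [])))
  ¬unit₃-3* x (inj₂ (r , eq)) = 3x≢1 (r - x) (≡-shift (sym eq) (solve (x ∷ r ∷ [])))

  -- Times of the form (u + i)/3.

  -- At t = (z/E + i)/3 the speed a stands at (F + r/E + ai)/3; since a² ≡ 1 mod 3, the choice
  -- i = a(1 − F) moves it to (1 + r/E)/3 mod 1, and a + 3e to (1 + (r + δ)/E)/3.
  thirds : ∀ a e c E z F r δ h j → 0ℤ < E → (∃[ q ] a * a ≡ 1ℤ + + 3 * q) →
           a * z ≡ F * E + r → 0ℤ ≤ r → 0ℤ ≤ δ → r + δ ≤ E →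
           + 3 * e * z ≡ δ + + 3 * E * h →
           E ≤ + 3 * (c * z) - + 3 * E * j → + 3 * (c * z) - + 3 * E * j ≤ + 2 * E →
           Attains (+ 3) 1ℤ (a ∷ a + + 3 * e ∷ + 3 * c ∷ [])
  thirds a e c E z F r δ h j 0<E (q , sq) az 0≤r 0≤δ r+δ≤E ez lo hi =
    + 3 * E , E , z + a * (1ℤ - F) * E , *-monoˡ-<-pos (+ 3) 0<E , ≤-reflexive (solve (E ∷ [])) ,
    (q * (1ℤ - F) ,
      ≤-shift (1ℤ ⊙ sym az ⊕ ((1ℤ - F) * E) ⊙ sym sq ⊕ 0≤r)
        (solve (a ∷ e ∷ c ∷ E ∷ z ∷ F ∷ r ∷ δ ∷ h ∷ j ∷ q ∷ [])) ,
      ≤-shift (1ℤ ⊙ az ⊕ ((1ℤ - F) * E) ⊙ sq ⊕ r+δ≤E ⊕ 0≤δ)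
        (solve (a ∷ e ∷ c ∷ E ∷ z ∷ F ∷ r ∷ δ ∷ h ∷ j ∷ q ∷ []))) ∷ᴬ
    (q * (1ℤ - F) + h + e * (a * (1ℤ - F)) ,
      ≤-shift (1ℤ ⊙ sym az ⊕ ((1ℤ - F) * E) ⊙ sym sq ⊕ 1ℤ ⊙ sym ez ⊕ 0≤r ⊕ 0≤δ)
        (solve (a ∷ e ∷ c ∷ E ∷ z ∷ F ∷ r ∷ δ ∷ h ∷ j ∷ q ∷ [])) ,
      ≤-shift (1ℤ ⊙ az ⊕ ((1ℤ - F) * E) ⊙ sq ⊕ 1ℤ ⊙ ez ⊕ r+δ≤E)
        (solve (a ∷ e ∷ c ∷ E ∷ z ∷ F ∷ r ∷ δ ∷ h ∷ j ∷ q ∷ []))) ∷ᴬ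
    (j + c * (a * (1ℤ - F)) ,
      ≤-shift lo
        (solve (a ∷ e ∷ c ∷ E ∷ z ∷ F ∷ r ∷ δ ∷ h ∷ j ∷ q ∷ [])) ,
      ≤-shift hi
        (solve (a ∷ e ∷ c ∷ E ∷ z ∷ F ∷ r ∷ δ ∷ h ∷ j ∷ q ∷ []))) ∷ᴬ []ᴬ

  -- If e ∤ c then some multiple of c/e lies in [1/3, 2/3] mod 1; at t = (z/e + i)/3 the
  -- runners a and a + 3e coincide, so a single shift i serves both.
  thirds-indivisible : ∀ {a e c F r} → Unit₃ a → 0ℤ < e →
                       c ≡ F * e + r → 0ℤ < r → r + 1ℤ ≤ e →
                       Attains (+ 3) 1ℤ (a ∷ a + + 3 * e ∷ + 3 * c ∷ [])
  thirds-indivisible {a} {e} {c} {F} {r} unit 0<e c≡ 0<r r<e = go (≤⊎suc≤ (+ 3 * r) (+ 2 * e))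
    where
    Goal = Attains (+ 3) 1ℤ (a ∷ a + + 3 * e ∷ + 3 * c ∷ [])
    finish : ∀ z j → e ≤ + 3 * (c * z) - + 3 * e * j → + 3 * (c * z) - + 3 * e * j ≤ + 2 * e → Goal
    finish z j lo hi = shift (euclid (a * z) 0<e)
      where
      shift : ∃[ G ] ∃[ ρ ] (a * z ≡ G * e + ρ × 0ℤ ≤ ρ × ρ + 1ℤ ≤ e) → Goal
      shift (G , ρ , az , 0≤ρ , ρ<e) = thirds a e c e z G ρ 0ℤ z j 0<e (unit₃-square unit) az 0≤ρ ≤-refl
        (≤-shift (ρ<e ⊕ 0≤1) (solve (ρ ∷ e ∷ []))) (solve (e ∷ z ∷ [])) lo hi
    low : ∃[ k ] (e ≤ + 3 * k * r × + 3 * k * r ≤ + 2 * e) → Goal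
    low (k , lo , hi) = finish k (k * F)
      (≤-shift (lo ⊕ (+ 3 * k) ⊙ sym c≡) (solve (e ∷ k ∷ r ∷ c ∷ F ∷ [])))
      (≤-shift (hi ⊕ (+ 3 * k) ⊙ c≡) (solve (e ∷ k ∷ r ∷ c ∷ F ∷ [])))
    -- For r > 2e/3 multiples of -c are used instead: its residue `e - r` is below e/3.
    high : ∃[ k ] (e ≤ + 3 * k * (e - r) × + 3 * k * (e - r) ≤ + 2 * e) → Goal
    high (k , lo , hi) = finish (- k) (- k * (F + 1ℤ))
      (≤-shift (lo ⊕ (+ 3 * k) ⊙ c≡) (solve (e ∷ k ∷ r ∷ c ∷ F ∷ [])))
      (≤-shift (hi ⊕ (+ 3 * k) ⊙ sym c≡) (solve (e ∷ k ∷ r ∷ c ∷ F ∷ [])))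
    go : _ → Goal
    go (inj₁ 3r≤2e) = low (landing 0<r 3r≤2e)
    go (inj₂ 2e<3r) = high (landing {e - r} {e} (1≤⇒0< (≤-shift r<e (solve (r ∷ e ∷ []))))
      (≤-shift (2e<3r ⊕ <⇒≤ 0<e ⊕ 0≤1) (solve (r ∷ e ∷ []))))

  -- At u = 1/(3c) the third runner has cu = 1/3, and two equal speeds need only one shift.
  thirds-equal : ∀ {a c} → Unit₃ a → 0ℤ < c →
                 Attains (+ 3) 1ℤ (a ∷ a + + 3 * 0ℤ ∷ + 3 * c ∷ [])
  thirds-equal {a} {c} unit 0<c = shift (euclid (a * 1ℤ) 0<3c)
    where
    0<3c : 0ℤ < + 3 * c
    0<3c = *-monoˡ-<-pos (+ 3) 0<c
    shift : ∃[ F ] ∃[ r ] (a * 1ℤ ≡ F * (+ 3 * c) + r × 0ℤ ≤ r × r + 1ℤ ≤ + 3 * c) →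
            Attains (+ 3) 1ℤ (a ∷ a + + 3 * 0ℤ ∷ + 3 * c ∷ [])
    shift (F , r , a≡ , 0≤r , r<3c) =
      thirds a 0ℤ c (+ 3 * c) 1ℤ F r 0ℤ 0ℤ 0ℤ 0<3c (unit₃-square unit) a≡ 0≤r ≤-refl
        (≤-shift (r<3c ⊕ 0≤1) (solve (r ∷ c ∷ []))) (solve (c ∷ []))
        (≤-reflexive (solve (c ∷ [])))
        (≤-shift (<⇒≤ 0<3c) (solve (c ∷ [])))

  -- Start from u = 1/(3fe), where feu = 1/3. Adding a multiple of 1/e to u changes feu by an
  -- integer and 3eu by a multiple of 3, while, a being invertible mod e, a suitable multiple brings
  -- au into [0, 1/e) mod 1. Modulo 3, (a + 3e)u lies 1/f further on, and e, f ≥ 2 give 1/e + 1/f ≤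
  -- 1.
  thirds-multiple : ∀ {a e f α β} → Unit₃ a → α * a + β * e ≡ 1ℤ →
                    + 2 ≤ e → + 2 ≤ f →
                    Attains (+ 3) 1ℤ (a ∷ a + + 3 * e ∷ + 3 * (f * e) ∷ [])
  thirds-multiple {a} {e} {f} {α} {β} unit bez 2≤e 2≤f = go (euclid a 0<3f)
    where
    0<f : 0ℤ < f
    0<f = <-≤-trans (+<+ (ℕ.s≤s ℕ.z≤n)) 2≤f
    0<e : 0ℤ < e
    0<e = <-≤-trans (+<+ (ℕ.s≤s ℕ.z≤n)) 2≤e
    0<3f : 0ℤ < + 3 * f
    0<3f = *-monoˡ-<-pos (+ 3) 0<f
    0<E : 0ℤ < + 3 * f * e
    0<E = subst (_< + 3 * f * e) (*-zeroʳ (+ 3 * f)) (*-monoˡ-<-pos (+ 3 * f) {{positive 0<3f}} 0<e)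
    go : ∃[ G ] ∃[ ρ ] (a ≡ G * (+ 3 * f) + ρ × 0ℤ ≤ ρ × ρ + 1ℤ ≤ + 3 * f) →
         Attains (+ 3) 1ℤ (a ∷ a + + 3 * e ∷ + 3 * (f * e) ∷ [])
    go (G , ρ , a≡ , 0≤ρ , ρ<3f) =
      thirds a e (f * e) (+ 3 * f * e) (1ℤ - + 3 * f * (G * α)) (G * β) ρ (+ 3 * e)
        (- (G * α)) (f * - (G * α))
        0<E (unit₃-square unit)
        (≡-shift (cong₂ (λ i j → i + + 3 * f * G * j) a≡ (sym bez))
          (solve (a ∷ e ∷ f ∷ α ∷ β ∷ G ∷ ρ ∷ [])))
        0≤ρ (≤-trans (+≤+ ℕ.z≤n) (+≤+ {0} {3} ℕ.z≤n ⊛ 2≤e))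
        (≤-shift (ρ<3f ⊕ 0≤1 ⊕ +≤+ {0} {3} ℕ.z≤n ⊛ (prod ⊕ 2≤e ⊕ 2≤f)) (solve (e ∷ f ∷ ρ ∷ [])))
        (solve (e ∷ f ∷ α ∷ G ∷ []))
        (≤-reflexive (solve (e ∷ f ∷ α ∷ G ∷ [])))
        (≤-shift (<⇒≤ 0<E) (solve (e ∷ f ∷ α ∷ G ∷ [])))
      where
      prod : (e - + 2) * 0ℤ ≤ (e - + 2) * (f - + 2)
      prod = i≤j⇒0≤j-i 2≤e ⊛ i≤j⇒0≤j-i 2≤f

  -- If a + 3 ≤ 3f, then at u = 1/(3f) both au and (a + 3)u lie in [0, 1] and fu = 1/3. Otherwise
  -- take u = k/a with a ≤ 3kf ≤ 2a: then au is an integer, and f ≥ 2 forces 3k ≤ a, so (a + 3)u is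
  -- at most 1 further on.
  thirds-consecutive : ∀ {a f} → Unit₃ a → 0ℤ < a → + 2 ≤ f →
                       Attains (+ 3) 1ℤ (a ∷ a + + 3 * 1ℤ ∷ + 3 * f ∷ [])
  thirds-consecutive {a} {f} unit 0<a 2≤f = go (≤⊎suc≤ (a + + 3) (+ 3 * f))
    where
    0<f : 0ℤ < f
    0<f = <-≤-trans (+<+ (ℕ.s≤s ℕ.z≤n)) 2≤f
    Goal = Attains (+ 3) 1ℤ (a ∷ a + + 3 * 1ℤ ∷ + 3 * f ∷ [])
    slow : ∃[ k ] (a ≤ + 3 * k * f × + 3 * k * f ≤ + 2 * a) → Goal
    slow (k , lo , hi) =
      thirds a 1ℤ f a k k 0ℤ (+ 3 * k) 0ℤ 0ℤ
        0<a (unit₃-square unit) (solve (a ∷ k ∷ [])) ≤-refl 0≤3k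
        (*-cancelˡ-≤-pos _ _ (+ 2)
          (≤-shift (hi ⊕ 0≤3k ⊛ 2≤f) (solve (a ∷ k ∷ f ∷ []))))
        (solve (a ∷ k ∷ []))
        (≤-shift lo (solve (a ∷ k ∷ f ∷ [])))
        (≤-shift hi (solve (a ∷ k ∷ f ∷ [])))
      where
      0≤3k : 0ℤ ≤ + 3 * k
      0≤3k = *-cancelʳ-≤-pos 0ℤ (+ 3 * k) f {{positive 0<f}}
        (≤-shift (<⇒≤ 0<a ⊕ lo) (solve (a ∷ k ∷ f ∷ [])))
    go : a + + 3 ≤ + 3 * f ⊎ + 3 * f + 1ℤ ≤ a + + 3 → Goal
    go (inj₁ a+3≤3f) =
      thirds a 1ℤ f (+ 3 * f) 1ℤ 0ℤ a (+ 3) 0ℤ 0ℤ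
        (*-monoˡ-<-pos (+ 3) 0<f) (unit₃-square unit) (solve (a ∷ f ∷ [])) (<⇒≤ 0<a) (+≤+ ℕ.z≤n) a+3≤3f
        (solve (f ∷ [])) (≤-reflexive (solve (f ∷ [])))
        (≤-shift (+≤+ {0} {3} ℕ.z≤n ⊛ <⇒≤ 0<f) (solve (f ∷ [])))
    go (inj₂ 3f<a+3) = slow (landing {f} {a} 0<f
      (≤-shift (+≤+ {0} {2} ℕ.z≤n ⊛ 3f<a+3 ⊕ +≤+ {0} {3} ℕ.z≤n ⊛ 2≤f ⊕ +≤+ {0} {2} ℕ.z≤n)
        (solve (a ∷ f ∷ []))))

  -- The two exceptional families.

  -- y stands at s/N and x at (s + 1)/N, where N = x + 2y = 3s + 1.
  sum-attains : ∀ {x y s α β} → α * x + β * y ≡ 1ℤ → x + + 2 * y ≡ + 3 * s + 1ℤ → 0ℤ ≤ s →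
                Attains (+ 3 * s + 1ℤ) s (x ∷ y ∷ x + y ∷ [])
  sum-attains {x} {y} {s} {α} {β} bez N≡ 0≤s =
    -- Modulo N one has x ≡ -2y, so `bez` makes β - 2α an inverse of y.
    + 3 * s + 1ℤ , s , s * (β - + 2 * α) ,
    1≤⇒0< (≤-shift (+≤+ {0} {3} ℕ.z≤n ⊛ 0≤s) (solve (s ∷ []))) , ≤-refl ,
    (s * β - 1ℤ ,
      ≤-shift ((s * (β - + 2 * α)) ⊙ sym N≡ ⊕ (+ 2 * s) ⊙ bez ⊕ (+ 2 * s * α) ⊙ sym N≡ ⊕ 0≤1)
        (solve (x ∷ y ∷ s ∷ α ∷ β ∷ [])) ,
      ≤-shift ((s * (β - + 2 * α)) ⊙ N≡ ⊕ (+ 2 * s) ⊙ sym bez ⊕ (+ 2 * s * α) ⊙ N≡ ⊕ 0≤s)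
        (solve (x ∷ y ∷ s ∷ α ∷ β ∷ []))) ∷ᴬ
    (- (s * α) ,
      ≤-shift (s ⊙ sym bez ⊕ (s * α) ⊙ N≡)
        (solve (x ∷ y ∷ s ∷ α ∷ β ∷ [])) ,
      ≤-shift (s ⊙ bez ⊕ (s * α) ⊙ sym N≡ ⊕ 0≤s ⊕ 0≤1)
        (solve (x ∷ y ∷ s ∷ α ∷ β ∷ []))) ∷ᴬ
    (s * β - s * α - 1ℤ ,
      ≤-shift ((s * (β - + 2 * α)) ⊙ sym N≡ ⊕ s ⊙ bez ⊕ (s * α) ⊙ sym N≡ ⊕ 0≤s ⊕ 0≤1)
        (solve (x ∷ y ∷ s ∷ α ∷ β ∷ [])) ,
      ≤-shift ((s * (β - + 2 * α)) ⊙ N≡ ⊕ s ⊙ sym bez ⊕ (s * α) ⊙ N≡)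
        (solve (x ∷ y ∷ s ∷ α ∷ β ∷ []))) ∷ᴬ []ᴬ

  private
    -- The fractional parts of xt, yt, (x + y)t give 3ρ ≤ 1, Nρ ≤ A and (2x + y)ρ ≤ x + y − A for an
    -- integer A.  If A ≤ s the second suffices; if A > s the third does, as 2x + y ≤ 2N.
    sum-bound : ∀ {x y s D m p k₁ k₂ k₃} → 0ℤ ≤ x → 0ℤ ≤ y → x + + 2 * y ≡ + 3 * s + 1ℤ → 0ℤ ≤ D →
                k₃ ≤ k₁ + k₂ → k₁ * D + m ≤ x * p → k₂ * D + m ≤ y * p →
                (x + y) * p + m ≤ (k₃ + 1ℤ) * D → m * (+ 3 * s + 1ℤ) ≤ s * D
    sum-bound {x} {y} {s} {D} {m} {p} {k₁} {k₂} {k₃} 0≤x 0≤y N≡ 0≤D k₃≤ L₁ L₂ U₃ =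
      go (≤⊎suc≤ (y * (k₁ + 1ℤ) - x * k₂) s)
      where
      P₁ : x * p ≤ (k₁ + 1ℤ) * D - + 2 * m
      P₁ = ≤-shift (0≤D ⊛ k₃≤ ⊕ U₃ ⊕ L₂) (solve (x ∷ y ∷ D ∷ m ∷ p ∷ k₁ ∷ k₂ ∷ k₃ ∷ []))
      P₂ : y * p ≤ (k₂ + 1ℤ) * D - + 2 * m
      P₂ = ≤-shift (0≤D ⊛ k₃≤ ⊕ U₃ ⊕ L₁) (solve (x ∷ y ∷ D ∷ m ∷ p ∷ k₁ ∷ k₂ ∷ k₃ ∷ []))
      3m≤D : 0ℤ ≤ D - + 3 * m
      3m≤D = ≤-shift (0≤D ⊛ k₃≤ ⊕ U₃ ⊕ L₁ ⊕ L₂) (solve (x ∷ y ∷ D ∷ m ∷ p ∷ k₁ ∷ k₂ ∷ k₃ ∷ []))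
      go : y * (k₁ + 1ℤ) - x * k₂ ≤ s ⊎ s + 1ℤ ≤ y * (k₁ + 1ℤ) - x * k₂ → m * (+ 3 * s + 1ℤ) ≤ s * D
      go (inj₁ A≤s) = ≤-shift (0≤y ⊛ P₁ ⊕ 0≤x ⊛ L₂ ⊕ 0≤D ⊛ A≤s ⊕ m ⊙ sym N≡)
        (solve (x ∷ y ∷ s ∷ D ∷ m ∷ p ∷ k₁ ∷ k₂ ∷ []))
      go (inj₂ s<A) = *-cancelˡ-≤-pos _ _ (+ 6) (≤-shift
        (+≤+ {0} {3} ℕ.z≤n ⊛ (0≤x ⊛ P₂ ⊕ 0≤y ⊛ L₁ ⊕ 0≤D ⊛ s<A) ⊕ 3m≤D ⊛ (+≤+ {0} {3} ℕ.z≤n ⊛ 0≤y)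
          ⊕ (+ 6 * m) ⊙ sym N≡ ⊕ (+ 3 * D) ⊙ N≡)
        (solve (x ∷ y ∷ s ∷ D ∷ m ∷ p ∷ k₁ ∷ k₂ ∷ [])))

  sum-bounded : ∀ {x y s} → 0ℤ ≤ x → 0ℤ ≤ y → x + + 2 * y ≡ + 3 * s + 1ℤ →
                Bounded (+ 3 * s + 1ℤ) s (x ∷ y ∷ x + y ∷ [])
  sum-bounded {x} {y} {s} 0≤x 0≤y N≡ {D} {m} {p} 0<D _
    ((k₁ , L₁ , U₁) ∷ᴬ (k₂ , L₂ , U₂) ∷ᴬ (k₃ , L₃ , U₃) ∷ᴬ []ᴬ) = go (≤⊎suc≤ k₃ (k₁ + k₂))
    where
    go : k₃ ≤ k₁ + k₂ ⊎ k₁ + k₂ + 1ℤ ≤ k₃ → m * (+ 3 * s + 1ℤ) ≤ s * D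
    go (inj₁ k₃≤) = sum-bound {x} {y} {s} {D} {m} {p} {k₁} {k₂} {k₃} 0≤x 0≤y N≡ (<⇒≤ 0<D) k₃≤ L₁ L₂ U₃
    -- Replace t by − t.
    go (inj₂ k₃>) = sum-bound {x} {y} {s} {D} {m} { - p} { - k₁ - 1ℤ} { - k₂ - 1ℤ} { - k₃ - 1ℤ}
      0≤x 0≤y N≡ (<⇒≤ 0<D)
      (≤-shift k₃> (solve (k₁ ∷ k₂ ∷ k₃ ∷ [])))
      (≤-shift U₁ (solve (x ∷ D ∷ m ∷ p ∷ k₁ ∷ [])))
      (≤-shift U₂ (solve (y ∷ D ∷ m ∷ p ∷ k₂ ∷ [])))
      (≤-shift L₃ (solve (x ∷ y ∷ D ∷ m ∷ p ∷ k₃ ∷ [])))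

  -- At t = s/(3s + 1) the runners stand at s, 2s and -s modulo 3s + 1.
  double-attains : ∀ {s} → 0ℤ ≤ s → Attains (+ 3 * s + 1ℤ) s (1ℤ ∷ + 2 ∷ + 3 * s ∷ [])
  double-attains {s} 0≤s =
    + 3 * s + 1ℤ , s , s ,
    1≤⇒0< (≤-shift (+≤+ {0} {3} ℕ.z≤n ⊛ 0≤s) (solve (s ∷ []))) , ≤-refl ,
    (0ℤ , ≤-reflexive (solve (s ∷ [])) , ≤-shift (0≤s ⊕ 0≤1) (solve (s ∷ []))) ∷ᴬ
    (0ℤ , ≤-shift 0≤s (solve (s ∷ [])) , ≤-shift 0≤1 (solve (s ∷ []))) ∷ᴬ
    (s - 1ℤ , ≤-shift (0≤s ⊕ 0≤1) (solve (s ∷ [])) , ≤-reflexive (solve (s ∷ []))) ∷ᴬ []ᴬ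

  private
    -- Put τ = p/D - k₁ and ρ = m/D. The first two runners give τ ≥ ρ and 2τ ≤ 1 - ρ. If k₃ - 3sk₁ ≥
    -- s, then 3sτ ≥ s + ρ, whence (3s + 2)ρ ≤ s; otherwise 3sτ + ρ ≤ s, and τ ≥ ρ finishes.
    double-bound : ∀ {s D m p k₁ k₂ k₃} → 0ℤ ≤ s → 0ℤ ≤ D → 0ℤ ≤ m → k₂ ≤ + 2 * k₁ →
                   k₁ * D + m ≤ 1ℤ * p → + 2 * p + m ≤ (k₂ + 1ℤ) * D →
                   k₃ * D + m ≤ + 3 * s * p → + 3 * s * p + m ≤ (k₃ + 1ℤ) * D →
                   m * (+ 3 * s + 1ℤ) ≤ s * D
    double-bound {s} {D} {m} {p} {k₁} {k₂} {k₃} 0≤s 0≤D 0≤m k₂≤ L₁ U₂ L₃ U₃ =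
      go (≤⊎suc≤ s (k₃ - + 3 * s * k₁))
      where
      3s : 0ℤ ≤ + 3 * s
      3s = +≤+ {0} {3} ℕ.z≤n ⊛ 0≤s
      go : s ≤ k₃ - + 3 * s * k₁ ⊎ k₃ - + 3 * s * k₁ + 1ℤ ≤ s → m * (+ 3 * s + 1ℤ) ≤ s * D
      go (inj₁ s≤k) = ≤-shift
        (+≤+ {0} {2} ℕ.z≤n ⊛ (0≤D ⊛ s≤k ⊕ L₃) ⊕ 3s ⊛ U₂ ⊕ 3s ⊛ (0≤D ⊛ k₂≤) ⊕ 0≤m)
        (solve (s ∷ D ∷ m ∷ p ∷ k₁ ∷ k₂ ∷ k₃ ∷ []))
      go (inj₂ k<s) = ≤-shift (3s ⊛ L₁ ⊕ U₃ ⊕ 0≤D ⊛ k<s) (solve (s ∷ D ∷ m ∷ p ∷ k₁ ∷ k₃ ∷ []))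

  double-bounded : ∀ {s} → 0ℤ ≤ s → Bounded (+ 3 * s + 1ℤ) s (1ℤ ∷ + 2 ∷ + 3 * s ∷ [])
  double-bounded {s} 0≤s {D} {m} {p} 0<D 0≤m
    ((k₁ , L₁ , U₁) ∷ᴬ (k₂ , L₂ , U₂) ∷ᴬ (k₃ , L₃ , U₃) ∷ᴬ []ᴬ) = go (≤⊎suc≤ k₂ (+ 2 * k₁))
    where
    go : k₂ ≤ + 2 * k₁ ⊎ + 2 * k₁ + 1ℤ ≤ k₂ → m * (+ 3 * s + 1ℤ) ≤ s * D
    go (inj₁ k₂≤) = double-bound {s} {D} {m} {p} {k₁} {k₂} {k₃} 0≤s (<⇒≤ 0<D) 0≤m k₂≤ L₁ U₂ L₃ U₃
    -- Reversing time brings the runner of speed 1 into the first half of its lap.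
    go (inj₂ k₂>) = double-bound {s} {D} {m} { - p} { - k₁ - 1ℤ} { - k₂ - 1ℤ} { - k₃ - 1ℤ}
      0≤s (<⇒≤ 0<D) 0≤m
      (≤-shift k₂> (solve (k₁ ∷ k₂ ∷ [])))
      (≤-shift U₁ (solve (D ∷ m ∷ p ∷ k₁ ∷ [])))
      (≤-shift L₂ (solve (D ∷ m ∷ p ∷ k₂ ∷ [])))
      (≤-shift U₃ (solve (s ∷ D ∷ m ∷ p ∷ k₃ ∷ [])))
      (≤-shift L₃ (solve (s ∷ D ∷ m ∷ p ∷ k₃ ∷ [])))

  -- Common divisors and Bézout coefficients.

  positive-factor : ∀ {g v w} → 0ℤ < g → 0ℤ < v → v ≡ g * w → 0ℤ < w
  positive-factor {g} 0<g 0<v v≡ =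
    *-cancelˡ-<-nonNeg g {{nonNegative (<⇒≤ 0<g)}}
      (subst₂ _<_ (sym (*-zeroʳ g)) v≡ 0<v)

  bézout : ∀ {u v} → 0ℤ < u → 0ℤ < v →
           ∃[ g ] ∃[ u′ ] ∃[ v′ ] ∃[ x ] ∃[ y ]
             (0ℤ < g × u ≡ g * u′ × v ≡ g * v′ × x * u′ + y * v′ ≡ 1ℤ)
  bézout {+0} (+<+ ())
  bézout {+[1+ _ ]} {+0} _ (+<+ ())
  bézout {u@(+[1+ m ])} {v@(+[1+ n ])} _ _ =
    from (gcd[m,n]∣m M N) (gcd[m,n]∣n M N) (combination (Bézout.identity (gcd-GCD M N)))
    where
    M = ℕ.suc m
    N = ℕ.suc n
    d = gcd M N
    g = + d
    0<g : 0ℤ < g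
    0<g = +<+ (ℕ.>-nonZero⁻¹ d {{ℕ.≢-nonZero (gcd[m,n]≢0 M N (inj₁ λ ()))}})
    -- Either form of the identity over ℕ reads d + ab = ce; over ℤ it becomes a combination with
    -- one negated coefficient.
    lift : ∀ a b c e → d ℕ.+ a ℕ.* b ≡ c ℕ.* e → + c * + e - + a * + b ≡ g
    lift a b c e eq = trans (cong₂ _-_ (trans (sym (pos-* c e)) (cong +_ (sym eq))) (sym (pos-* a b)))
      (+-cancel g (+ (a ℕ.* b)))
      where
      +-cancel : ∀ x y → x + y - y ≡ x
      +-cancel x y = solve (x ∷ y ∷ [])
    combination : Bézout.Identity d M N → ∃[ x ] ∃[ y ] (x * u + y * v ≡ g)
    combination (Bézout.+- x y eq) = + x , - + y ,
      trans (cong (_+_ (+ x * u)) (sym (neg-distribˡ-* (+ y) v))) (lift y N x M eq)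
    combination (Bézout.-+ x y eq) = - + x , + y ,
      trans (+-comm (- + x * u) (+ y * v))
        (trans (cong (_+_ (+ y * v)) (sym (neg-distribˡ-* (+ x) u))) (lift x M y N eq))
    from : d ∣ M → d ∣ N → ∃[ x ] ∃[ y ] (x * u + y * v ≡ g) →
           ∃[ g ] ∃[ u′ ] ∃[ v′ ] ∃[ x ] ∃[ y ]
             (0ℤ < g × u ≡ g * u′ × v ≡ g * v′ × x * u′ + y * v′ ≡ 1ℤ)
    from (divides q M≡) (divides r N≡) (x , y , eq) =
      g , + q , + r , x , y , 0<g , u≡ , v≡ , cancel
      where
      u≡ : u ≡ g * + q
      u≡ = trans (cong +_ M≡) (trans (pos-* q d) (*-comm (+ q) g))
      v≡ : v ≡ g * + r
      v≡ = trans (cong +_ N≡) (trans (pos-* r d) (*-comm (+ r) g))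
      cancel : x * + q + y * + r ≡ 1ℤ
      cancel = *-cancelˡ-≡ g _ _ {{>-nonZero 0<g}} (trans (factor g x y (+ q) (+ r))
        (trans (cong₂ (λ a b → x * a + y * b) (sym u≡) (sym v≡)) (trans eq (sym (*-identityʳ g)))))
        where
        factor : ∀ g x y q r → g * (x * q + y * r) ≡ x * (g * q) + y * (g * r)
        factor g x y q r = solve (g ∷ x ∷ y ∷ q ∷ r ∷ [])

  -- Invariance under order and sign of the speeds.

  infix 4 _≈_ _≡±_

  -- Both directions are kept because `Attains` is transported forwards and `Bounded` backwards.
  record _≈_ (vs ws : List ℤ) : Set where
    field
      to   : ∀ {D m p} → Lonely D m p vs → Lonely D m p ws
      from : ∀ {D m p} → Lonely D m p ws → Lonely D m p vs

  open _≈_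

  ≈-trans : ∀ {us} → us ≈ vs → vs ≈ ws → us ≈ ws
  ≈-trans us≈vs vs≈ws .to   = to vs≈ws ∘ to us≈vs
  ≈-trans us≈vs vs≈ws .from = from us≈vs ∘ from vs≈ws

  ↭⇒≈ : vs ↭ ws → vs ≈ ws
  ↭⇒≈ vs↭ws .to   = All-resp-↭ vs↭ws
  ↭⇒≈ vs↭ws .from = All-resp-↭ (↭-sym vs↭ws)

  _≡±_ : ℤ → ℤ → Set
  v ≡± w = w ≡ v ⊎ w ≡ - v

  ≡±-sym : ∀ {v w} → v ≡± w → w ≡± v
  ≡±-sym (inj₁ w≡v) = inj₁ (sym w≡v)
  ≡±-sym (inj₂ w≡-v) = inj₂ (trans (sym (neg-involutive _)) (cong -_ (sym w≡-v)))

  ±⇒≈ : Pointwise _≡±_ vs ws → vs ≈ ws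
  ±⇒≈ vs±ws = record
    { to = transfer vs±ws ; from = transfer (Pointwise.symmetric ≡±-sym vs±ws) }
    where
    transfer : ∀ {vs ws D m p} → Pointwise _≡±_ vs ws → Lonely D m p vs → Lonely D m p ws
    transfer []ᴾ []ᴬ = []ᴬ
    transfer (inj₁ refl ∷ᴾ rest) (c ∷ᴬ cs) = c ∷ᴬ transfer rest cs
    transfer {v ∷ _} {_} {D} {m} {p} (inj₂ refl ∷ᴾ rest) (c ∷ᴬ cs) =
      subst (Clear D m) (neg-distribˡ-* v p) (clear-neg c) ∷ᴬ transfer rest cs

  attains-resp : ∀ N s → vs ≈ ws → Attains N s vs → Attains N s ws
  attains-resp _ _ vs≈ws (D , m , p , 0<D , sD≤mN , lonely) =
    D , m , p , 0<D , sD≤mN , to vs≈ws lonely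

  -- Three speeds with exactly one multiple of 3.

  -- In the case `large` only a lower bound is recorded; the exact maximum is supplied separately by
  -- `maximum-exists`.
  data Outcome (vs : List ℤ) : Set where
    exact : ∀ s → 1ℤ ≤ s → Attains (+ 3 * s + 1ℤ) s vs → Bounded (+ 3 * s + 1ℤ) s vs → Outcome vs
    large : Attains (+ 3) 1ℤ vs → Outcome vs

  outcome-resp : Outcome vs → vs ≈ ws → Outcome ws
  outcome-resp (exact s 1≤s attains bounded) vs≈ws =
    exact s 1≤s (attains-resp (+ 3 * s + 1ℤ) s vs≈ws attains)
      λ 0<D 0≤m → bounded 0<D 0≤m ∘ from vs≈ws
  outcome-resp (large attains) vs≈ws = large (attains-resp (+ 3) 1ℤ vs≈ws attains)

  -- If x = y + 1 + 3r then x + 2y = 3(y + r) + 1, which fixes s = y + r; in the other case x and y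
  -- trade places.
  sum-outcome : ∀ {x y α β} → 0ℤ < x → 0ℤ < y → α * x + β * y ≡ 1ℤ →
                (∃[ r ] x ≡ y + (1ℤ + + 3 * r)) ⊎ (∃[ r ] y ≡ x + (1ℤ + + 3 * r)) →
                Outcome (x ∷ y ∷ x + y ∷ [])
  sum-outcome {x} {y} {α} {β} 0<x 0<y bez (inj₁ (r , x≡)) =
    exact (y + r) 1≤s (sum-attains {x} {y} {y + r} {α} {β} bez N≡ (≤-trans 0≤1 1≤s))
      (sum-bounded {x} {y} {y + r} (<⇒≤ 0<x) (<⇒≤ 0<y) N≡)
    where
    N≡ : x + + 2 * y ≡ + 3 * (y + r) + 1ℤ
    N≡ = ≡-shift x≡ (solve (x ∷ y ∷ r ∷ []))
    1≤s : 1ℤ ≤ y + r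
    1≤s = 0<⇒1≤ (*-cancelˡ-<-nonNeg (+ 3) (1≤⇒0< (≤-shift
      (1ℤ ⊙ N≡ ⊕ 0<⇒1≤ 0<x ⊕ +≤+ {0} {2} ℕ.z≤n ⊛ 0<⇒1≤ 0<y ⊕ 0≤1) (solve (x ∷ y ∷ r ∷ [])))))
  sum-outcome {x} {y} {α} {β} 0<x 0<y bez (inj₂ y≡) =
    outcome-resp
      (subst (λ z → Outcome (y ∷ x ∷ z ∷ [])) (+-comm y x)
        (sum-outcome {y} {x} {β} {α} 0<y 0<x (trans (+-comm (β * y) (α * x)) bez) (inj₁ y≡)))
      (↭⇒≈ (swap y x ↭-refl))

  double-outcome : ∀ {s} → 1ℤ ≤ s → Outcome (1ℤ ∷ + 2 ∷ + 3 * s ∷ [])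
  double-outcome {s} 1≤s = exact s 1≤s (double-attains 0≤s) (double-bounded 0≤s)
    where 0≤s = ≤-trans 0≤1 1≤s

  -- Up to sign, a ↦ -a - 3 exchanges the speeds a and a + 3, so a ≤ -4 reduces to a positive speed.
  -- What remains is a = -1 and a = -2, both giving 1, 2, 3f.
  consecutive-outcome : ∀ {a f} → Unit₃ a → + 2 ≤ f → Outcome (a ∷ a + + 3 * 1ℤ ∷ + 3 * f ∷ [])
  consecutive-outcome {+0} unit _ = contradiction unit (¬unit₃-3* 0ℤ)
  consecutive-outcome {+[1+ n ]} unit 2≤f =
    large (thirds-consecutive unit (+<+ (ℕ.s≤s ℕ.z≤n)) 2≤f)
  consecutive-outcome { -[1+ 0 ]} unit 2≤f =
    outcome-resp
      (double-outcome (≤-trans (+≤+ (ℕ.s≤s ℕ.z≤n)) 2≤f))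
      (±⇒≈ (inj₂ refl ∷ᴾ inj₁ refl ∷ᴾ inj₁ refl ∷ᴾ []ᴾ))
  consecutive-outcome { -[1+ 1 ]} {f} unit 2≤f =
    outcome-resp
      (outcome-resp
        (double-outcome (≤-trans (+≤+ (ℕ.s≤s ℕ.z≤n)) 2≤f))
        (±⇒≈ (inj₁ refl ∷ᴾ inj₂ refl ∷ᴾ inj₁ refl ∷ᴾ []ᴾ)))
      (↭⇒≈ (swap 1ℤ -[1+ 1 ] ↭-refl))
  consecutive-outcome { -[1+ 2 ]} unit _ = contradiction unit (¬unit₃-3* -1ℤ)
  consecutive-outcome {a@(-[1+ ℕ.suc (ℕ.suc (ℕ.suc n)) ])} {f} unit 2≤f =
    outcome-resp
      (large (thirds-consecutive (unit₃-shift -1ℤ (unit₃-neg unit))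
        (+<+ (ℕ.s≤s ℕ.z≤n)) 2≤f))
      (reflect a f)
    where
    reflect : ∀ a f → (- a + + 3 * -1ℤ) ∷ (- a + + 3 * -1ℤ) + + 3 * 1ℤ ∷ + 3 * f ∷ [] ≈
              a ∷ a + + 3 * 1ℤ ∷ + 3 * f ∷ []
    reflect a f = ≈-trans (↭⇒≈ (swap _ _ ↭-refl))
      (±⇒≈ (inj₂ (solve (a ∷ [])) ∷ᴾ inj₂ (solve (a ∷ [])) ∷ᴾ inj₁ refl ∷ᴾ []ᴾ))

  unit₃≢0 : ∀ {a} → Unit₃ a → a ≢ 0ℤ
  unit₃≢0 unit refl = ¬unit₃-3* 0ℤ unit

  -- The triple is (x, y, x + y) up to order and signs; which of its members is x + y depends
  -- on the signs of a and a + 3e.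
  difference-outcome : ∀ {a e α β γ} → Unit₃ a → 0ℤ < e →
                       α * a + β * (a + + 3 * e) + γ * (+ 3 * e) ≡ 1ℤ →
                       Outcome (a ∷ a + + 3 * e ∷ + 3 * e ∷ [])
  difference-outcome {a} {e} {α} {β} {γ} unit 0<e bez = go (<-cmp 0ℤ a) (<-cmp 0ℤ (a + + 3 * e))
    where
    0<3e : 0ℤ < + 3 * e
    0<3e = *-monoˡ-<-pos (+ 3) 0<e
    go : Tri (0ℤ < a) (0ℤ ≡ a) (a < 0ℤ) →
         Tri (0ℤ < a + + 3 * e) (0ℤ ≡ a + + 3 * e) (a + + 3 * e < 0ℤ) →
         Outcome (a ∷ a + + 3 * e ∷ + 3 * e ∷ [])
    go (tri≈ _ 0≡a _) _ = contradiction (sym 0≡a) (unit₃≢0 unit)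
    go _ (tri≈ _ 0≡b _) = contradiction (sym 0≡b) (unit₃≢0 (unit₃-shift e unit))
    go (tri< 0<a _ _) _ = outcome-resp
      (sum-outcome {a} {+ 3 * e} {α + β} {β + γ} 0<a 0<3e
        (≡-shift bez (solve (a ∷ e ∷ α ∷ β ∷ γ ∷ []))) (residues unit))
      (↭⇒≈ (prep a (swap (+ 3 * e) (a + + 3 * e) ↭-refl)))
      where
      residues : Unit₃ a → (∃[ r ] a ≡ + 3 * e + (1ℤ + + 3 * r)) ⊎ (∃[ r ] + 3 * e ≡ a + (1ℤ + + 3 * r))
      residues (inj₁ (r , a≡)) = inj₁ (r - e , ≡-shift a≡ (solve (a ∷ e ∷ r ∷ [])))
      residues (inj₂ (r , a≡)) = inj₂ (e - r , ≡-shift (sym a≡) (solve (a ∷ e ∷ r ∷ [])))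
    go (tri> _ _ a<0) (tri< 0<b _ _) =
      outcome-resp
        (sum-outcome { - a} {a + + 3 * e} {γ - α} {β + γ} (neg-mono-< a<0) 0<b
          (≡-shift bez (solve (a ∷ e ∷ α ∷ β ∷ γ ∷ []))) (residues unit))
        (±⇒≈ (inj₂ (solve (a ∷ [])) ∷ᴾ inj₁ refl ∷ᴾ inj₁ (solve (a ∷ e ∷ [])) ∷ᴾ []ᴾ))
      where
      -- Here x - y = -2a - 3e ≡ a modulo 3, so the difference is again ±1.
      residues : Unit₃ a → (∃[ r ] - a ≡ a + + 3 * e + (1ℤ + + 3 * r)) ⊎
                           (∃[ r ] a + + 3 * e ≡ - a + (1ℤ + + 3 * r))
      residues (inj₁ (r , a≡)) = inj₁ (- 1ℤ - + 2 * r - e ,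
        ≡-shift (cong (+ 2 *_) (sym a≡)) (solve (a ∷ e ∷ r ∷ [])))
      residues (inj₂ (r , a≡)) = inj₂ (+ 2 * r - 1ℤ + e ,
        ≡-shift (cong (+ 2 *_) a≡) (solve (a ∷ e ∷ r ∷ [])))
    go (tri> _ _ _) (tri> _ _ b<0) =
      outcome-resp
        (outcome-resp
          (sum-outcome { - (a + + 3 * e)} {+ 3 * e} { - α - β} {γ - α} (neg-mono-< b<0) 0<3e
            (≡-shift bez (solve (a ∷ e ∷ α ∷ β ∷ γ ∷ []))) (residues unit))
          (↭⇒≈ (↭-trans (prep _ (swap (+ 3 * e) (- (a + + 3 * e) + + 3 * e) ↭-refl)) (swap _ _ ↭-refl))))
        (±⇒≈ (inj₂ (solve (a ∷ e ∷ [])) ∷ᴾ inj₂ (solve (a ∷ e ∷ [])) ∷ᴾ inj₁ refl ∷ᴾ []ᴾ))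
      where
      residues : Unit₃ a → (∃[ r ] - (a + + 3 * e) ≡ + 3 * e + (1ℤ + + 3 * r)) ⊎
                           (∃[ r ] + 3 * e ≡ - (a + + 3 * e) + (1ℤ + + 3 * r))
      residues (inj₁ (r , a≡)) = inj₂ (r + + 2 * e , ≡-shift a≡ (solve (a ∷ e ∷ r ∷ [])))
      residues (inj₂ (r , a≡)) = inj₁ (- r - + 2 * e , ≡-shift (sym a≡) (solve (a ∷ e ∷ r ∷ [])))

  private
    multiple-bézout : ∀ {a e f α β γ} → α * a + β * (a + + 3 * e) + γ * (+ 3 * (f * e)) ≡ 1ℤ →
                      (α + β) * a + (+ 3 * β + + 3 * γ * f) * e ≡ 1ℤ
    multiple-bézout {a} {e} {f} {α} {β} {γ} bez = ≡-shift bez (solve (a ∷ e ∷ f ∷ α ∷ β ∷ γ ∷ []))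

  -- The cases are e = 0; e not dividing c; c = e, the family x, y, x + y; e = 1 with c ≥ 2, which
  -- contains 1, 2, 3c; and e ≥ 2 with c/e ≥ 2.
  one-multiple : ∀ {a e c α β γ} → Unit₃ a → 0ℤ ≤ e → 0ℤ < c →
                 α * a + β * (a + + 3 * e) + γ * (+ 3 * c) ≡ 1ℤ →
                 Outcome (a ∷ a + + 3 * e ∷ + 3 * c ∷ [])
  one-multiple {e = +0} unit _ 0<c _ = large (thirds-equal unit 0<c)
  one-multiple {a} {e@(+[1+ n ])} {c} {α} {β} {γ} unit _ 0<c bez = go (euclid c 0<e)
    where
    0<e : 0ℤ < e
    0<e = +<+ (ℕ.s≤s ℕ.z≤n)
    divisible : ∀ {F} n → c ≡ F * +[1+ n ] → 0ℤ < F →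
                α * a + β * (a + + 3 * +[1+ n ]) + γ * (+ 3 * c) ≡ 1ℤ →
                Outcome (a ∷ a + + 3 * +[1+ n ] ∷ + 3 * c ∷ [])
    divisible {+0} _ _ (+<+ ())
    divisible {+[1+ 0 ]} n c≡ _ bez =
      subst (λ c → Outcome (a ∷ a + + 3 * d ∷ + 3 * c ∷ [])) (sym c≡d)
        (difference-outcome {a} {d} {α} {β} {γ} unit (+<+ (ℕ.s≤s ℕ.z≤n))
          (subst (λ c → α * a + β * (a + + 3 * d) + γ * (+ 3 * c) ≡ 1ℤ) c≡d bez))
      where
      d = +[1+ n ]
      c≡d : c ≡ d
      c≡d = trans c≡ (*-identityˡ d)
    divisible {f@(+[1+ ℕ.suc m ])} 0 refl _ _ =
      subst (λ c → Outcome (a ∷ a + + 3 * 1ℤ ∷ + 3 * c ∷ [])) (sym (*-identityʳ f))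
        (consecutive-outcome unit (+≤+ (ℕ.s≤s (ℕ.s≤s ℕ.z≤n))))
    divisible {f@(+[1+ ℕ.suc m ])} n@(ℕ.suc _) refl _ bez =
      large (thirds-multiple {a} {+[1+ n ]} {f} {α + β} {+ 3 * β + + 3 * γ * f} unit
        (multiple-bézout {a} {+[1+ n ]} {f} {α} {β} {γ} bez)
        (+≤+ (ℕ.s≤s (ℕ.s≤s ℕ.z≤n))) (+≤+ (ℕ.s≤s (ℕ.s≤s ℕ.z≤n))))
    go : ∃[ F ] ∃[ r ] (c ≡ F * e + r × 0ℤ ≤ r × r + 1ℤ ≤ e) → Outcome (a ∷ a + + 3 * e ∷ + 3 * c ∷ [])
    go (F , +0 , c≡ , _ , _) =
      divisible n c≡Fe (positive-factor 0<e 0<c (trans c≡Fe (*-comm F e))) bez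
      where
      c≡Fe : c ≡ F * e
      c≡Fe = trans c≡ (+-identityʳ (F * e))
    go (F , r@(+[1+ _ ]) , c≡ , _ , r<e) =
      large (thirds-indivisible {a} {e} {c} {F} {r} unit 0<e c≡ (+<+ (ℕ.s≤s ℕ.z≤n)) r<e)

  -- Common factors and comparison of values.

  -- Speeds multiplied by g take the same positions at time t/g, so `D` and `m` are scaled and `p`
  -- is kept.
  attains-scale : ∀ N s {g vs} → 0ℤ < g → Attains N s vs → Attains N s (map (g *_) vs)
  attains-scale N s {g} 0<g (D , m , p , 0<D , sD≤mN , lonely) =
    g * D , g * m , p ,
    subst (_< g * D) (*-zeroʳ g) (*-monoˡ-<-pos g {{positive 0<g}} 0<D) ,
    ≤-shift (<⇒≤ 0<g ⊛ sD≤mN) (solve (g ∷ D ∷ m ∷ N ∷ s ∷ [])) ,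
    map⁺ (All.map (λ {v} → scale v) lonely)
    where
    scale : ∀ v → Clear D m (v * p) → Clear (g * D) (g * m) (g * v * p)
    scale v (k , lo , hi) = k ,
      ≤-shift (<⇒≤ 0<g ⊛ lo) (solve (g ∷ D ∷ m ∷ k ∷ v ∷ p ∷ [])) ,
      ≤-shift (<⇒≤ 0<g ⊛ hi) (solve (g ∷ D ∷ m ∷ k ∷ v ∷ p ∷ []))

  bounded-scale : ∀ {N s vs} g → Bounded N s vs → Bounded N s (map (g *_) vs)
  bounded-scale g bounded {D} {m} {p} 0<D 0≤m lonely = bounded 0<D 0≤m
    (All.map (λ {v} → subst (Clear D m) (reassociate v)) (map⁻ lonely))
    where
    reassociate : ∀ v → g * v * p ≡ v * (g * p)
    reassociate v = solve (g ∷ v ∷ p ∷ [])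

  attains-weaken : ∀ N s N′ s′ {vs} → 0ℤ < N → 0ℤ ≤ N′ → s′ * N ≤ s * N′ →
                   Attains N s vs → Attains N′ s′ vs
  attains-weaken N s N′ s′ 0<N 0≤N′ le (D , m , p , 0<D , sD≤mN , lonely) =
    D , m , p , 0<D ,
    *-cancelˡ-≤-pos (s′ * D) (m * N′) N {{positive 0<N}}
      (≤-shift (<⇒≤ 0<D ⊛ le ⊕ 0≤N′ ⊛ sD≤mN) (solve (N ∷ s ∷ N′ ∷ s′ ∷ D ∷ m ∷ []))) ,
    lonely

  bounded-weaken : ∀ N s N′ s′ {vs} → 0ℤ < N → 0ℤ ≤ N′ → s * N′ ≤ s′ * N →
                   Bounded N s vs → Bounded N′ s′ vs
  bounded-weaken N s N′ s′ 0<N 0≤N′ le bounded {D} {m} {p} 0<D 0≤m lonely =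
    *-cancelˡ-≤-pos (m * N′) (s′ * D) N {{positive 0<N}}
      (≤-shift (<⇒≤ 0<D ⊛ le ⊕ 0≤N′ ⊛ bounded {D} {m} {p} 0<D 0≤m lonely)
        (solve (N ∷ s ∷ N′ ∷ s′ ∷ D ∷ m ∷ [])))

  -- The dichotomy for two speeds.

  data Outcome₂ (vs : List ℤ) : Set where
    odd  : ∀ s → 1ℤ ≤ s → Attains (+ 2 * s + 1ℤ) s vs → Bounded (+ 2 * s + 1ℤ) s vs → Outcome₂ vs
    even : Attains (+ 2) 1ℤ vs → Bounded (+ 2) 1ℤ vs → Outcome₂ vs

  pair-outcome : ∀ {u v} → 0ℤ < u → 0ℤ < v → Outcome₂ (u ∷ v ∷ [])
  pair-outcome {u} {v} 0<u 0<v = go (bézout 0<u 0<v)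
    where
    parity : ∀ {g u v x y} → 0ℤ < g → 0ℤ < u → 0ℤ < v → x * u + y * v ≡ 1ℤ →
             ∃[ s ] ∃[ r ] (u + v ≡ s * + 2 + r × 0ℤ ≤ r × r + 1ℤ ≤ + 2) → Outcome₂ (g * u ∷ g * v ∷ [])
    parity {g} {u} {v} {x} {y} 0<g 0<u 0<v bez (s , r , N≡ , 0≤r , r<2) = finish r 0≤r r<2 N≡
      where
      0<N : 0ℤ < u + v
      0<N = +-mono-< 0<u 0<v
      attains : Attains (u + v) s (g * u ∷ g * v ∷ [])
      attains = attains-scale (u + v) s 0<g (pair-attains {u} {v} {s} {x} {y} 0<N bez
        (≤-shift (≤-reflexive (sym N≡) ⊕ 0≤r) (solve (u ∷ v ∷ s ∷ r ∷ []))))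
      bounded : Bounded (u + v) s (g * u ∷ g * v ∷ [])
      bounded = bounded-scale {u + v} {s} g (pair-bounded {u} {v} {s} (<⇒≤ 0<u) (<⇒≤ 0<v)
        (≤-shift (≤-reflexive N≡ ⊕ r<2) (solve (u ∷ v ∷ s ∷ r ∷ []))))
      1≤s : 1ℤ ≤ s
      1≤s = 0<⇒1≤ (*-cancelˡ-<-nonNeg (+ 2) (1≤⇒0< (≤-shift
        (0<⇒1≤ 0<u ⊕ 0<⇒1≤ 0<v ⊕ ≤-reflexive N≡ ⊕ r<2) (solve (u ∷ v ∷ s ∷ r ∷ [])))))
      finish : ∀ r → 0ℤ ≤ r → r + 1ℤ ≤ + 2 → u + v ≡ s * + 2 + r → Outcome₂ (g * u ∷ g * v ∷ [])
      finish +0 _ _ N≡ = even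
        (attains-weaken (u + v) s (+ 2) 1ℤ 0<N (+≤+ ℕ.z≤n)
          (≤-shift (≤-reflexive N≡) (solve (u ∷ v ∷ s ∷ []))) attains)
        (bounded-weaken (u + v) s (+ 2) 1ℤ 0<N (+≤+ ℕ.z≤n)
          (≤-shift (≤-reflexive (sym N≡)) (solve (u ∷ v ∷ s ∷ []))) bounded)
      finish +[1+ 0 ] _ _ N≡ = odd s 1≤s
        (subst (λ N → Attains N s (g * u ∷ g * v ∷ [])) N≡′ attains)
        (subst (λ N → Bounded N s (g * u ∷ g * v ∷ [])) N≡′ bounded)
        where
        N≡′ : u + v ≡ + 2 * s + 1ℤ
        N≡′ = ≡-shift N≡ (solve (u ∷ v ∷ s ∷ []))
      finish +[1+ ℕ.suc n ] _ (+≤+ (ℕ.s≤s (ℕ.s≤s n+1≤0))) _ =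
        contradiction (ℕ.m+n≤o⇒n≤o n n+1≤0) λ ()
    go : ∃[ g ] ∃[ u′ ] ∃[ v′ ] ∃[ x ] ∃[ y ]
           (0ℤ < g × u ≡ g * u′ × v ≡ g * v′ × x * u′ + y * v′ ≡ 1ℤ) → Outcome₂ (u ∷ v ∷ [])
    go (g , u′ , v′ , x , y , 0<g , u≡ , v≡ , bez) =
      subst₂ (λ u v → Outcome₂ (u ∷ v ∷ [])) (sym u≡) (sym v≡)
        (parity {g} {u′} {v′} {x} {y} 0<g (positive-factor 0<g 0<u u≡) (positive-factor 0<g 0<v v≡) bez
          (euclid (u′ + v′) (+<+ (ℕ.s≤s ℕ.z≤n))))

  -- Three speeds: assembling the cases modulo 3.

  pair-third : ∀ {u v} → 0ℤ < u → 0ℤ < v → Attains (+ 3) 1ℤ (u ∷ v ∷ [])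
  pair-third 0<u 0<v with pair-outcome 0<u 0<v
  ... | odd s 1≤s attains _ =
    attains-weaken (+ 2 * s + 1ℤ) s (+ 3) 1ℤ (1≤⇒0< (le₁ s 1≤s)) (+≤+ ℕ.z≤n) (le₂ s 1≤s) attains
    where
    le₁ : ∀ s → 1ℤ ≤ s → 1ℤ ≤ + 2 * s + 1ℤ
    le₁ s 1≤s = ≤-shift (+≤+ {0} {2} ℕ.z≤n ⊛ (0≤1 ⊕ 1≤s)) (solve (s ∷ []))
    le₂ : ∀ s → 1ℤ ≤ s → 1ℤ * (+ 2 * s + 1ℤ) ≤ s * + 3
    le₂ s 1≤s = ≤-shift 1≤s (solve (s ∷ []))
  ... | even attains _ =
    attains-weaken (+ 2) 1ℤ (+ 3) 1ℤ (+<+ (ℕ.s≤s ℕ.z≤n)) (+≤+ ℕ.z≤n) (+≤+ (ℕ.s≤s (ℕ.s≤s ℕ.z≤n))) attains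

  -- At time (t + i)/3 the runners 3a and 3b stand where a and b stand at time t, while i = u(1 - F)
  -- moves u into [1/3, 2/3], by the same computation as in `thirds`.
  two-multiples : ∀ {a b u} → Attains (+ 3) 1ℤ (a ∷ b ∷ []) → Unit₃ u →
                  Attains (+ 3) 1ℤ (+ 3 * a ∷ + 3 * b ∷ u ∷ [])
  two-multiples {a} {b} {u} (D , m , p , 0<D , D≤3m , clear-a ∷ᴬ clear-b ∷ᴬ []ᴬ) unit =
    go (euclid (u * p) 0<D) (unit₃-square unit)
    where
    triple : ∀ v i → Clear D m (v * p) → Clear (+ 3 * D) D (+ 3 * v * (p + i * D))
    triple v i (k , lo , hi) = k + v * i ,
      ≤-shift (D≤3m ⊕ +≤+ {0} {3} ℕ.z≤n ⊛ lo) (solve (D ∷ m ∷ p ∷ v ∷ i ∷ k ∷ [])) ,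
      ≤-shift (D≤3m ⊕ +≤+ {0} {3} ℕ.z≤n ⊛ hi) (solve (D ∷ m ∷ p ∷ v ∷ i ∷ k ∷ []))
    go : ∃[ F ] ∃[ r ] (u * p ≡ F * D + r × 0ℤ ≤ r × r + 1ℤ ≤ D) → ∃[ q ] u * u ≡ 1ℤ + + 3 * q →
         Attains (+ 3) 1ℤ (+ 3 * a ∷ + 3 * b ∷ u ∷ [])
    go (F , r , up , 0≤r , r<D) (q , sq) =
      + 3 * D , D , p + u * (1ℤ - F) * D , *-monoˡ-<-pos (+ 3) 0<D , ≤-reflexive (solve (D ∷ [])) ,
      triple a (u * (1ℤ - F)) clear-a ∷ᴬ triple b (u * (1ℤ - F)) clear-b ∷ᴬ
      (q * (1ℤ - F) ,
        ≤-shift (1ℤ ⊙ sym up ⊕ ((1ℤ - F) * D) ⊙ sym sq ⊕ 0≤r) (solve (D ∷ p ∷ u ∷ F ∷ r ∷ q ∷ [])) ,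
        ≤-shift (1ℤ ⊙ up ⊕ ((1ℤ - F) * D) ⊙ sq ⊕ r<D ⊕ 0≤1) (solve (D ∷ p ∷ u ∷ F ∷ r ∷ q ∷ []))) ∷ᴬ []ᴬ

  no-multiples : ∀ {vs} → All Unit₃ vs → Attains (+ 3) 1ℤ vs
  no-multiples units = + 3 , 1ℤ , 1ℤ , +<+ (ℕ.s≤s ℕ.z≤n) , ≤-refl , All.map clear units
    where
    clear : ∀ {v} → Unit₃ v → Clear (+ 3) 1ℤ (v * 1ℤ)
    clear (inj₁ (r , refl)) = r ,
      ≤-reflexive (solve (r ∷ [])) , ≤-shift 0≤1 (solve (r ∷ []))
    clear (inj₂ (r , refl)) = r - 1ℤ ,
      ≤-shift 0≤1 (solve (r ∷ [])) , ≤-reflexive (solve (r ∷ []))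

  congruent-outcome : ∀ {a b e c α β γ} → Unit₃ a → b ≡ a + + 3 * e → 0ℤ < c →
                      α * a + β * b + γ * (+ 3 * c) ≡ 1ℤ → Outcome (a ∷ b ∷ + 3 * c ∷ [])
  congruent-outcome {a} {_} {e} {c} {α} {β} {γ} unit refl 0<c bez = go (≤-total 0ℤ e)
    where
    go : 0ℤ ≤ e ⊎ e ≤ 0ℤ → Outcome (a ∷ a + + 3 * e ∷ + 3 * c ∷ [])
    go (inj₁ 0≤e) = one-multiple {a} {e} {c} {α} {β} {γ} unit 0≤e 0<c bez
    go (inj₂ e≤0) = outcome-resp
      (subst (λ z → Outcome (a + + 3 * e ∷ z ∷ + 3 * c ∷ [])) back
        (one-multiple {a + + 3 * e} { - e} {c} {β} {α} {γ} (unit₃-shift e unit) (neg-mono-≤ e≤0) 0<c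
          (≡-shift bez (solve (a ∷ e ∷ c ∷ α ∷ β ∷ γ ∷ [])))))
      (↭⇒≈ (swap _ _ ↭-refl))
      where
      back : a + + 3 * e + + 3 * - e ≡ a
      back = solve (a ∷ e ∷ [])

  -- Residues of opposite sign modulo 3 are made equal by replacing b with -b, which leaves the
  -- loneliness unchanged.
  units-outcome : ∀ {a b c α β γ} → Unit₃ a → Unit₃ b → 0ℤ < c →
                  α * a + β * b + γ * (+ 3 * c) ≡ 1ℤ → Outcome (a ∷ b ∷ + 3 * c ∷ [])
  units-outcome {a} {b} {c} {α} {β} {γ} unit-a unit-b 0<c bez = go unit-a unit-b
    where
    same : ∀ e → b ≡ a + + 3 * e → Outcome (a ∷ b ∷ + 3 * c ∷ [])
    same e b≡ = congruent-outcome {a} {b} {e} {c} {α} {β} {γ} unit-a b≡ 0<c bez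
    opposite : ∀ e → - b ≡ a + + 3 * e → Outcome (a ∷ b ∷ + 3 * c ∷ [])
    opposite e b≡ = outcome-resp
      (congruent-outcome {a} { - b} {e} {c} {α} { - β} {γ} unit-a b≡ 0<c
        (≡-shift bez (solve (a ∷ b ∷ c ∷ α ∷ β ∷ γ ∷ []))))
      (±⇒≈ (inj₁ refl ∷ᴾ inj₂ (sym (neg-involutive b)) ∷ᴾ inj₁ refl ∷ᴾ []ᴾ))
    go : Unit₃ a → Unit₃ b → Outcome (a ∷ b ∷ + 3 * c ∷ [])
    go (inj₁ (r , a≡)) (inj₁ (t , b≡)) = same (t - r)
      (≡-shift (cong₂ _-_ b≡ a≡) (solve (a ∷ b ∷ r ∷ t ∷ [])))
    go (inj₂ (r , a≡)) (inj₂ (t , b≡)) = same (t - r)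
      (≡-shift (cong₂ _-_ b≡ a≡) (solve (a ∷ b ∷ r ∷ t ∷ [])))
    go (inj₁ (r , a≡)) (inj₂ (t , b≡)) = opposite (- t - r)
      (≡-shift (sym (cong₂ _+_ b≡ a≡)) (solve (a ∷ b ∷ r ∷ t ∷ [])))
    go (inj₂ (r , a≡)) (inj₁ (t , b≡)) = opposite (- t - r)
      (≡-shift (sym (cong₂ _+_ b≡ a≡)) (solve (a ∷ b ∷ r ∷ t ∷ [])))

  Multiple₃ : ℤ → Set
  Multiple₃ v = ∃[ c ] v ≡ + 3 * c

  residue₃ : ∀ v → Multiple₃ v ⊎ Unit₃ v
  residue₃ v = go (euclid v (+<+ (ℕ.s≤s ℕ.z≤n)))
    where
    go : ∃[ F ] ∃[ r ] (v ≡ F * + 3 + r × 0ℤ ≤ r × r + 1ℤ ≤ + 3) → Multiple₃ v ⊎ Unit₃ v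
    go (F , +0 , v≡ , _) = inj₁ (F , ≡-shift v≡ (solve (v ∷ F ∷ [])))
    go (F , +[1+ 0 ] , v≡ , _) = inj₂ (inj₁ (F , ≡-shift v≡ (solve (v ∷ F ∷ []))))
    go (F , +[1+ 1 ] , v≡ , _) = inj₂ (inj₂ (F + 1ℤ , ≡-shift v≡ (solve (v ∷ F ∷ []))))
    go (F , +[1+ ℕ.suc (ℕ.suc n) ] , _ , _ , +≤+ (ℕ.s≤s (ℕ.s≤s (ℕ.s≤s n+1≤0)))) =
      contradiction (ℕ.m+n≤o⇒n≤o n n+1≤0) λ ()

  coprime-triple-outcome : ∀ {u v w α β γ} → 0ℤ < u → 0ℤ < v → 0ℤ < w →
                           α * u + β * v + γ * w ≡ 1ℤ → Outcome (u ∷ v ∷ w ∷ [])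
  coprime-triple-outcome {u} {v} {w} {α} {β} {γ} 0<u 0<v 0<w bez =
    go (residue₃ u) (residue₃ v) (residue₃ w)
    where
    0<3 : 0ℤ < + 3
    0<3 = +<+ (ℕ.s≤s ℕ.z≤n)
    quotient : ∀ {v c} → 0ℤ < v → v ≡ + 3 * c → 0ℤ < c
    quotient = positive-factor 0<3
    go : Multiple₃ u ⊎ Unit₃ u → Multiple₃ v ⊎ Unit₃ v → Multiple₃ w ⊎ Unit₃ w → Outcome (u ∷ v ∷ w ∷ [])
    go (inj₂ u′) (inj₂ v′) (inj₂ w′) = large (no-multiples (u′ ∷ᴬ v′ ∷ᴬ w′ ∷ᴬ []ᴬ))
    go (inj₂ u′) (inj₂ v′) (inj₁ (c , refl)) =
      units-outcome {u} {v} {c} {α} {β} {γ} u′ v′ (quotient 0<w refl) bez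
    go (inj₂ u′) (inj₁ (c , refl)) (inj₂ w′) = outcome-resp
      (units-outcome {u} {w} {c} {α} {γ} {β} u′ w′ (quotient 0<v refl)
        (≡-shift bez (solve (u ∷ w ∷ c ∷ α ∷ β ∷ γ ∷ []))))
      (↭⇒≈ (prep u (swap _ _ ↭-refl)))
    go (inj₁ (c , refl)) (inj₂ v′) (inj₂ w′) = outcome-resp
      (units-outcome {v} {w} {c} {β} {γ} {α} v′ w′ (quotient 0<u refl)
        (≡-shift bez (solve (v ∷ w ∷ c ∷ α ∷ β ∷ γ ∷ []))))
      (↭⇒≈ (↭-trans (prep v (swap _ _ ↭-refl)) (swap _ _ ↭-refl)))
    go (inj₁ (a , refl)) (inj₁ (b , refl)) (inj₂ w′) =
      large (two-multiples (pair-third (quotient 0<u refl) (quotient 0<v refl)) w′)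
    go (inj₁ (a , refl)) (inj₂ v′) (inj₁ (b , refl)) = outcome-resp
      (large (two-multiples (pair-third (quotient 0<u refl) (quotient 0<w refl)) v′))
      (↭⇒≈ (prep u (swap _ _ ↭-refl)))
    go (inj₂ u′) (inj₁ (a , refl)) (inj₁ (b , refl)) = outcome-resp
      (large (two-multiples (pair-third (quotient 0<v refl) (quotient 0<w refl)) u′))
      (↭⇒≈ (↭-trans (prep v (swap _ _ ↭-refl)) (swap _ _ ↭-refl)))
    -- A common factor 3 would divide the Bézout combination, which is 1.
    go (inj₁ (a , refl)) (inj₁ (b , refl)) (inj₁ (c , refl)) = ⊥-elim
      (3x≢1 (α * a + β * b + γ * c) (≡-shift bez (solve (a ∷ b ∷ c ∷ α ∷ β ∷ γ ∷ []))))

  -- The gcd of the three speeds is split off in two Bézout steps, whose coefficients multiply to a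
  -- relation for the quotients.
  triple-outcome : ∀ {u v w} → 0ℤ < u → 0ℤ < v → 0ℤ < w → Outcome (u ∷ v ∷ w ∷ [])
  triple-outcome {u} {v} {w} 0<u 0<v 0<w with bézout 0<u 0<v
  ... | h , u′ , v′ , x , y , 0<h , refl , refl , bez with bézout 0<h 0<w
  ... | g , h′ , w′ , x′ , y′ , 0<g , refl , refl , bez′ =
    subst₂ (λ a b → Outcome (a ∷ b ∷ g * w′ ∷ [])) (sym (*-assoc g h′ u′)) (sym (*-assoc g h′ v′))
      (scale (coprime-triple-outcome {h′ * u′} {h′ * v′} {w′} {x′ * x} {x′ * y} {y′}
        (positive-factor 0<g 0<u (*-assoc g h′ u′))
        (positive-factor 0<g 0<v (*-assoc g h′ v′))
        (positive-factor 0<g 0<w refl) (combine h′ u′ v′ w′ x y x′ y′ bez bez′)))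
    where
    scale : ∀ {vs} → Outcome vs → Outcome (map (g *_) vs)
    scale (exact s 1≤s attains bounded) =
      exact s 1≤s (attains-scale (+ 3 * s + 1ℤ) s 0<g attains)
        (bounded-scale {+ 3 * s + 1ℤ} {s} g bounded)
    scale (large attains) = large (attains-scale (+ 3) 1ℤ 0<g attains)
    combine : ∀ h u v w x y x′ y′ → x * u + y * v ≡ 1ℤ → x′ * h + y′ * w ≡ 1ℤ →
              x′ * x * (h * u) + x′ * y * (h * v) + y′ * w ≡ 1ℤ
    combine h u v w x y x′ y′ bez bez′ =
      ≡-shift (cong₂ (λ i j → x′ * h * i + j) bez bez′) (solve (h ∷ u ∷ v ∷ w ∷ x ∷ y ∷ x′ ∷ y′ ∷ []))

  -- Improving a time to a multiple of 1/(u + v).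

  -- A speed v together with the integer part k of v t.
  Lap : Set
  Lap = ℤ × ℤ

  Within : ℤ → ℤ → ℤ → Lap → Set
  Within D m p (v , k) = 0ℤ < v × k * D + m ≤ v * p × v * p + m ≤ (k + 1ℤ) * D

  -- The integer parts hidden in `Lonely` are exposed as data, so that pairs of runners can be
  -- compared.
  laps : ∀ {D m p vs} → All (0ℤ <_) vs → Lonely D m p vs →
         ∃[ ls ] (map proj₁ ls ≡ vs × All (Within D m p) ls)
  laps []ᴬ []ᴬ = [] , refl , []ᴬ
  laps (0<v ∷ᴬ 0<vs) ((k , lo , hi) ∷ᴬ lonely) with laps 0<vs lonely
  ... | ls , refl , within = (_ , k) ∷ ls , refl , (0<v , lo , hi) ∷ᴬ within

  -- The bound that pair-bound puts on the loneliness, for u + v > 0.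
  slack : Lap × Lap → ℚᵘ
  slack ((u , k) , (v , l)) = mkℚᵘ ((l + 1ℤ) * u - k * v) (ℕ.pred ∣ u + v ∣)

  slack-≤ : ∀ {u k v l u′ k′ v′ l′} → 0ℤ < u + v → 0ℤ < u′ + v′ →
            slack ((u , k) , (v , l)) ℚᵘ.≤ slack ((u′ , k′) , (v′ , l′)) →
            ((l + 1ℤ) * u - k * v) * (u′ + v′) ≤ ((l′ + 1ℤ) * u′ - k′ * v′) * (u + v)
  slack-≤ {u} {k} {v} {l} {u′} {k′} {v′} {l′} 0<N 0<N′ (*≤* le) =
    subst₂ (λ N N′ → ((l + 1ℤ) * u - k * v) * N′ ≤ ((l′ + 1ℤ) * u′ - k′ * v′) * N)
      (den 0<N) (den 0<N′) le
    where
    den : ∀ {N} → 0ℤ < N → + ℕ.suc (ℕ.pred ∣ N ∣) ≡ N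
    den {+0} (+<+ ())
    den {+[1+ _ ]} _ = refl

  LeastSlack : List Lap → Lap → Lap → Set
  LeastSlack ls x y = ∀ {x′ y′} → x′ ∈ ls → y′ ∈ ls → slack (x , y) ℚᵘ.≤ slack (x′ , y′)

  -- The minimum runs over all ordered pairs, including a lap paired with itself, whose slack is 1/2
  -- when its speed is positive.
  least-slack : ∀ c cs → ∃[ x ] ∃[ y ] (x ∈ c ∷ cs × y ∈ c ∷ cs × LeastSlack (c ∷ cs) x y)
  least-slack c cs = proj₁ best , proj₂ best , proj₁ best∈ , proj₂ best∈ ,
    λ x∈ y∈ → All.lookup (f[argmin]≤f[xs] {f = slack} (c , c) pairs) (∈-cartesianProduct⁺ x∈ y∈)
    where
    pairs = cartesianProduct (c ∷ cs) (c ∷ cs)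
    best = argmin slack (c , c) pairs
    best∈ : proj₁ best ∈ c ∷ cs × proj₂ best ∈ c ∷ cs
    best∈ = argmin-all slack {P = λ b → proj₁ b ∈ c ∷ cs × proj₂ b ∈ c ∷ cs} (here refl , here refl)
      (All.tabulate (∈-cartesianProduct⁻ (c ∷ cs) (c ∷ cs)))

  -- At t = (k + l + 1)/(u + v) the runners u and v are equally far from the ends of their laps.
  balanced : ∀ {D m p ls u k v l} → All (Within D m p) ls → (u , k) ∈ ls → (v , l) ∈ ls →
             LeastSlack ls (u , k) (v , l) →
             Lonely (u + v) ((l + 1ℤ) * u - k * v) (k + l + 1ℤ) (map proj₁ ls)
  balanced {ls = ls} {u} {k} {v} {l} within u∈ v∈ least =
    map⁺ (All.tabulate λ {x} x∈ → proj₂ x , lower (proj₁ x) (proj₂ x) x∈ , upper (proj₁ x) (proj₂ x) x∈)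
    where
    0<_at_ : ∀ {j} w → (w , j) ∈ ls → 0ℤ < w
    0< w at w∈ = proj₁ (All.lookup within w∈)
    0<u : 0ℤ < u
    0<u = 0< u at u∈
    0<v : 0ℤ < v
    0<v = 0< v at v∈
    -- Minimality against the pair with `w` in place of `u` keeps `w` away from the start of its
    -- lap; in `upper`, `w` replaces `v` and is kept away from the end.
    lower : ∀ w j → (w , j) ∈ ls → j * (u + v) + ((l + 1ℤ) * u - k * v) ≤ w * (k + l + 1ℤ)
    lower w j w∈ = *-cancelˡ-≤-pos _ _ v {{positive 0<v}}
      (≤-shift (slack-≤ {u} {k} {v} {l} {w} {j} {v} {l}
          (+-mono-< 0<u 0<v) (+-mono-< (0< w at w∈) 0<v) (least w∈ v∈))
        (solve (u ∷ k ∷ v ∷ l ∷ w ∷ j ∷ [])))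
    upper : ∀ w j → (w , j) ∈ ls → w * (k + l + 1ℤ) + ((l + 1ℤ) * u - k * v) ≤ (j + 1ℤ) * (u + v)
    upper w j w∈ = *-cancelˡ-≤-pos _ _ u {{positive 0<u}}
      (≤-shift (slack-≤ {u} {k} {v} {l} {u} {k} {w} {j}
          (+-mono-< 0<u 0<v) (+-mono-< 0<u (0< w at w∈)) (least u∈ w∈))
        (solve (u ∷ k ∷ v ∷ l ∷ w ∷ j ∷ [])))

  -- By `pair-bound` the least slack is no smaller than m/D, and by `balanced` that slack is itself
  -- reached as a loneliness.
  critical : ∀ {D m p vs} → All (0ℤ <_) vs → ∀ {w} → w ∈ vs → Lonely D m p vs →
             ∃[ u ] ∃[ v ] ∃[ A ] ∃[ L ]
               (u ∈ vs × v ∈ vs × m * (u + v) ≤ A * D × Lonely (u + v) A L vs)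
  critical {D} {m} {p} {vs} 0<vs {w} w∈vs lonely = choose (laps 0<vs lonely) w∈vs
    where
    Goal : List ℤ → Set
    Goal vs = ∃[ u ] ∃[ v ] ∃[ A ] ∃[ L ]
                (u ∈ vs × v ∈ vs × m * (u + v) ≤ A * D × Lonely (u + v) A L vs)
    at : ∀ {ls u k v l} → All (Within D m p) ls → (u , k) ∈ ls → (v , l) ∈ ls →
         LeastSlack ls (u , k) (v , l) →
         Goal (map proj₁ ls)
    at {ls} {u} {k} {v} {l} within u∈ v∈ least =
      u , v , (l + 1ℤ) * u - k * v , k + l + 1ℤ , ∈-map⁺ proj₁ u∈ , ∈-map⁺ proj₁ v∈ ,
      bound (All.lookup within u∈) (All.lookup within v∈) , balanced within u∈ v∈ least
      where
      bound : Within D m p (u , k) → Within D m p (v , l) →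
              m * (u + v) ≤ ((l + 1ℤ) * u - k * v) * D
      bound (0<u , lo , _) (0<v , _ , hi) =
        pair-bound {D} {m} {p} {u} {v} {k} {l} (<⇒≤ 0<u) (<⇒≤ 0<v) lo hi
    choose : ∃[ ls ] (map proj₁ ls ≡ vs × All (Within D m p) ls) → w ∈ vs → Goal vs
    choose ([] , refl , _) ()
    choose (c ∷ cs , refl , within) _ = least (least-slack c cs)
      where
      least : ∃[ x ] ∃[ y ] (x ∈ c ∷ cs × y ∈ c ∷ cs × LeastSlack (c ∷ cs) x y) →
              Goal (map proj₁ (c ∷ cs))
      least ((u , k) , (v , l) , x∈ , y∈ , min) = at within x∈ y∈ min

  -- Positions depend on time modulo 1 only, which leaves finitely many multiples of 1/N.
  lonely-mod : ∀ {N A L vs} → 0ℤ < N → Lonely N A L vs →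
               ∃[ l ] (+ l < N × Lonely N A (+ l) vs)
  lonely-mod {N} {A} {L} 0<N lonely = reduce (euclid L 0<N)
    where
    reduce : ∃[ F ] ∃[ r ] (L ≡ F * N + r × 0ℤ ≤ r × r + 1ℤ ≤ N) →
             ∃[ l ] (+ l < N × Lonely N A (+ l) _)
    reduce (F , + l , L≡ , _ , l<N) = l ,
      suc[i]≤j⇒i<j (subst (_≤ N) (+-comm (+ l) 1ℤ) l<N) ,
      All.map (λ {v} → shift (+ l) L≡ v) lonely
      where
      shift : ∀ r → L ≡ F * N + r → ∀ v → Clear N A (v * L) → Clear N A (v * r)
      shift r L≡ v (k , lo , hi) = k - v * F ,
        ≤-shift (lo ⊕ v ⊙ L≡) (solve (N ∷ A ∷ L ∷ F ∷ r ∷ v ∷ k ∷ [])) ,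
        ≤-shift (hi ⊕ v ⊙ sym L≡) (solve (N ∷ A ∷ L ∷ F ∷ r ∷ v ∷ k ∷ []))

-- From integer inequalities to rational and real times.

module Rational where

  open Integral
  open import Data.Integer as ℤ using (ℤ; +_; 0ℤ; 1ℤ)
  import Data.Integer.Properties as ℤ
  open import Data.Integer.Tactic.RingSolver using (solve)
  open import Data.List as List using (List; concatMap; cartesianProduct; upTo)
    renaming ([] to []ˡ; _∷_ to _∷ˡ_)
  import Data.List.Extrema
  open import Data.List.Membership.Propositional using (_∈_; lose)
  open import Data.List.Membership.Propositional.Properties
    using (∈-concatMap⁺; ∈-cartesianProduct⁺; ∈-map⁺; ∈-map⁻; ∈-upTo⁺)
  open import Data.List.Relation.Unary.All as All using (All; []; _∷_)
  open import Data.List.Relation.Unary.All.Properties using (map⁺; map⁻)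
  open import Data.List.Relation.Unary.Any using (here)
  open import Data.Nat as ℕ using (ℕ; zero; suc)
  import Data.Nat.Properties as ℕ
  open import Data.Product using (_×_; _,_; ∃-syntax; proj₁; proj₂)
  open import Data.Rational
  open import Data.Rational.Properties
  import Data.Rational.Unnormalised as ℚᵘ
  import Data.Rational.Unnormalised.Properties as ℚᵘ
  open import Data.Sum using (_⊎_; inj₁; inj₂)
  open import Data.Vec as Vec using (Vec; []; _∷_; foldr₁; toList)
  open import Relation.Binary.Bundles using (DecTotalOrder)
  open import Relation.Binary.PropositionalEquality
  open Data.List.Extrema (DecTotalOrder.totalOrder ≤-decTotalOrder) using (argmax; f[xs]≤f[argmax])

  toℚᵘ-/ : ∀ i n → toℚᵘ (i / suc n) ℚᵘ.≃ ℚᵘ.mkℚᵘ i n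
  toℚᵘ-/ i n = toℚᵘ-fromℚᵘ (ℚᵘ.mkℚᵘ i n)

  /-mono-≤ : ∀ i m j n → i ℤ.* + suc n ℤ.≤ j ℤ.* + suc m → i / suc m ≤ j / suc n
  /-mono-≤ i m j n le = toℚᵘ-cancel-≤
    (ℚᵘ.≤-respʳ-≃ (ℚᵘ.≃-sym (toℚᵘ-/ j n)) (ℚᵘ.≤-respˡ-≃ (ℚᵘ.≃-sym (toℚᵘ-/ i m)) (ℚᵘ.*≤* le)))

  /-cancel-≤ : ∀ i m j n → i / suc m ≤ j / suc n → i ℤ.* + suc n ℤ.≤ j ℤ.* + suc m
  /-cancel-≤ i m j n le = ℚᵘ.drop-*≤*
    (ℚᵘ.≤-respʳ-≃ (toℚᵘ-/ j n) (ℚᵘ.≤-respˡ-≃ (toℚᵘ-/ i m) (toℚᵘ-mono-≤ le)))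

  /-cong-≡ : ∀ i m j n → i ℤ.* + suc n ≡ j ℤ.* + suc m → i / suc m ≡ j / suc n
  /-cong-≡ i m j n eq = ≤-antisym
    (/-mono-≤ i m j n (ℤ.≤-reflexive eq)) (/-mono-≤ j n i m (ℤ.≤-reflexive (sym eq)))

  /-monoˡ-≤ : ∀ {i j} n → i ℤ.≤ j → i / suc n ≤ j / suc n
  /-monoˡ-≤ {i} {j} n i≤j = /-mono-≤ i n j n (ℤ.*-monoʳ-≤-nonNeg (+ suc n) i≤j)

  /-cancelˡ-≤ : ∀ i j n → i / suc n ≤ j / suc n → i ℤ.≤ j
  /-cancelˡ-≤ i j n le = ℤ.*-cancelʳ-≤-pos i j (+ suc n) (/-cancel-≤ i n j n le)

  neg-/ : ∀ i n → - (i / suc n) ≡ (ℤ.- i) / suc n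
  neg-/ i n = toℚᵘ-injective (ℚᵘ.≃-trans (toℚᵘ-homo‿- (i / suc n))
    (ℚᵘ.≃-trans (ℚᵘ.-‿cong (toℚᵘ-/ i n)) (ℚᵘ.≃-sym (toℚᵘ-/ (ℤ.- i) n))))

  /-sub-integer : ∀ i k n → i / suc n - k / 1 ≡ (i ℤ.- k ℤ.* + suc n) / suc n
  /-sub-integer i k n = toℚᵘ-injective (ℚᵘ.≃-trans (toℚᵘ-homo-+ (i / suc n) (- (k / 1)))
    (ℚᵘ.≃-trans (ℚᵘ.+-cong (toℚᵘ-/ i n) (ℚᵘ.≃-trans (toℚᵘ-homo‿- (k / 1)) (ℚᵘ.-‿cong (toℚᵘ-/ k 0))))
    (ℚᵘ.≃-trans (ℚᵘ.*≡* (cross i k (+ suc n))) (ℚᵘ.≃-sym (toℚᵘ-/ (i ℤ.- k ℤ.* + suc n) n)))))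
    where
    cross : ∀ i k N → (i ℤ.* 1ℤ ℤ.+ ℤ.- k ℤ.* N) ℤ.* N ≡ (i ℤ.- k ℤ.* N) ℤ.* (N ℤ.* 1ℤ)
    cross i k N = solve (i ∷ˡ k ∷ˡ N ∷ˡ []ˡ)

  integer-*-/ : ∀ v i n → v / 1 * (i / suc n) ≡ (v ℤ.* i) / suc n
  integer-*-/ v i n = toℚᵘ-injective (ℚᵘ.≃-trans (toℚᵘ-homo-* (v / 1) (i / suc n))
    (ℚᵘ.≃-trans (ℚᵘ.*-cong (toℚᵘ-/ v 0) (toℚᵘ-/ i n))
    (ℚᵘ.≃-trans (ℚᵘ.*≡* (cross v i (+ suc n))) (ℚᵘ.≃-sym (toℚᵘ-/ (v ℤ.* i) n)))))
    where
    cross : ∀ v i N → v ℤ.* i ℤ.* N ≡ v ℤ.* i ℤ.* (1ℤ ℤ.* N)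
    cross v i N = solve (v ∷ˡ i ∷ˡ N ∷ˡ []ˡ)

  common-denominator : ∀ p q → ∃[ d ] ∃[ i ] ∃[ j ] (p ≡ i / suc d × q ≡ j / suc d)
  common-denominator p@(mkℚ i m _) q@(mkℚ j n _) =
    n ℕ.+ m ℕ.* suc n , i ℤ.* + suc n , j ℤ.* + suc m ,
    trans (sym (↥p/↧p≡p p)) (/-cong-≡ i m (i ℤ.* + suc n) (n ℕ.+ m ℕ.* suc n)
      (trans (cong (i ℤ.*_) (ℤ.pos-* (suc m) (suc n))) (cross i (+ suc m) (+ suc n)))) ,
    trans (sym (↥p/↧p≡p q)) (/-cong-≡ j n (j ℤ.* + suc m) (n ℕ.+ m ℕ.* suc n)
      (trans (cong (j ℤ.*_) (ℤ.pos-* (suc m) (suc n))) (cross′ j (+ suc m) (+ suc n))))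
    where
    cross : ∀ i M N → i ℤ.* (M ℤ.* N) ≡ i ℤ.* N ℤ.* M
    cross i M N = solve (i ∷ˡ M ∷ˡ N ∷ˡ []ˡ)
    cross′ : ∀ i M N → i ℤ.* (M ℤ.* N) ≡ i ℤ.* M ℤ.* N
    cross′ i M N = solve (i ∷ˡ M ∷ˡ N ∷ˡ []ˡ)

  p≤∣p∣ : ∀ p → p ≤ ∣ p ∣
  p≤∣p∣ p with ≤-total 0ℚ p
  ... | inj₁ 0≤p = ≤-reflexive (sym (0≤p⇒∣p∣≡p 0≤p))
  ... | inj₂ p≤0 = ≤-trans p≤0 (0≤∣p∣ p)

  ∣-/-∣-integer : ∀ x k n → ∣ x / suc n - k / 1 ∣ ≡ ∣ (x ℤ.- k ℤ.* + suc n) / suc n ∣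
  ∣-/-∣-integer x k n = cong ∣_∣ (/-sub-integer x k n)

  0≤/ : ∀ {i} n → 0ℤ ℤ.≤ i → 0ℚ ≤ i / suc n
  0≤/ {i} n 0≤i = /-mono-≤ 0ℤ 0 i n (ℤ.≤-trans 0≤i (ℤ.≤-reflexive (sym (ℤ.*-identityʳ i))))

  -- The integer chosen by `round` is at most k or at least k + 1, and on either side `Clear` gives
  -- the distance.
  clear⇒≤‖‖ : ∀ {x} d m → Clear (+ suc d) m x → m / suc d ≤ ‖ x / suc d ‖ℚ
  clear⇒≤‖‖ {x} d m (k , lo , hi) = subst (m / suc d ≤_) (sym (∣-/-∣-integer x r d)) (go (≤⊎suc≤ r k))
    where
    D = + suc d
    r = round (x / suc d)
    below : ∀ D r → r ℤ.≤ k → k ℤ.* D ℤ.+ m ℤ.≤ x → 0ℤ ℤ.≤ D → m ℤ.≤ x ℤ.- r ℤ.* D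
    below D r r≤k lo 0≤D = ≤-shift (lo ⊕ 0≤D ⊛ r≤k) (solve (D ∷ˡ r ∷ˡ k ∷ˡ m ∷ˡ x ∷ˡ []ˡ))
    above : ∀ D r → k ℤ.+ 1ℤ ℤ.≤ r → x ℤ.+ m ℤ.≤ (k ℤ.+ 1ℤ) ℤ.* D → 0ℤ ℤ.≤ D →
            m ℤ.≤ ℤ.- (x ℤ.- r ℤ.* D)
    above D r k<r hi 0≤D = ≤-shift (hi ⊕ 0≤D ⊛ k<r) (solve (D ∷ˡ r ∷ˡ k ∷ˡ m ∷ˡ x ∷ˡ []ˡ))
    go : _ → m / suc d ≤ ∣ (x ℤ.- r ℤ.* D) / suc d ∣
    go (inj₁ r≤k) = ≤-trans (/-monoˡ-≤ d (below D r r≤k lo (ℤ.+≤+ ℕ.z≤n))) (p≤∣p∣ _)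
    go (inj₂ k<r) = ≤-trans (/-monoˡ-≤ d (above D r k<r hi (ℤ.+≤+ ℕ.z≤n)))
      (subst (_≤ ∣ y ∣) (neg-/ (x ℤ.- r ℤ.* D) d) (subst (- y ≤_) (∣-p∣≡∣p∣ y) (p≤∣p∣ (- y))))
      where y = (x ℤ.- r ℤ.* D) / suc d

  -- It is enough to test the two integers enclosing x/D, the floor k and k + 1: there the sign
  -- inside the absolute value is known.
  ≤‖‖⇒clear : ∀ {x} d m → m / suc d ≤ ‖ x / suc d ‖ℚ → Clear (+ suc d) m x
  ≤‖‖⇒clear {x} d m far = go (euclid x (ℤ.+<+ (ℕ.s≤s ℕ.z≤n)))
    where
    near : ∀ k → m / suc d ≤ ∣ (x ℤ.- k ℤ.* + suc d) / suc d ∣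
    near k = subst (m / suc d ≤_) (∣-/-∣-integer x k d) (≤-trans far (‖‖ℚ-nearest (x / suc d) k))
    near⁺ : ∀ k → 0ℤ ℤ.≤ x ℤ.- k ℤ.* + suc d → m ℤ.≤ x ℤ.- k ℤ.* + suc d
    near⁺ k 0≤y = /-cancelˡ-≤ m _ d (subst (m / suc d ≤_) (0≤p⇒∣p∣≡p (0≤/ d 0≤y)) (near k))
    near⁻ : ∀ k → 0ℤ ℤ.≤ ℤ.- (x ℤ.- k ℤ.* + suc d) → m ℤ.≤ ℤ.- (x ℤ.- k ℤ.* + suc d)
    near⁻ k 0≤-y = /-cancelˡ-≤ m _ d (subst (m / suc d ≤_)
      (trans (sym (∣-p∣≡∣p∣ y)) (trans (cong ∣_∣ (neg-/ (x ℤ.- k ℤ.* + suc d) d)) (0≤p⇒∣p∣≡p (0≤/ d 0≤-y))))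
      (near k))
      where y = (x ℤ.- k ℤ.* + suc d) / suc d
    clear : ∀ D k → m ℤ.≤ x ℤ.- k ℤ.* D → m ℤ.≤ ℤ.- (x ℤ.- (k ℤ.+ 1ℤ) ℤ.* D) → Clear D m x
    clear D k lo hi = k ,
      ≤-shift lo (solve (D ∷ˡ k ∷ˡ m ∷ˡ x ∷ˡ []ˡ)) ,
      ≤-shift hi (solve (D ∷ˡ k ∷ˡ m ∷ˡ x ∷ˡ []ˡ))
    floor-bounds : ∀ {D k r} → x ≡ k ℤ.* D ℤ.+ r → 0ℤ ℤ.≤ r → r ℤ.+ 1ℤ ℤ.≤ D →
                   0ℤ ℤ.≤ x ℤ.- k ℤ.* D × 0ℤ ℤ.≤ ℤ.- (x ℤ.- (k ℤ.+ 1ℤ) ℤ.* D)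
    floor-bounds {D} {k} {r} x≡ 0≤r r<D =
      ≤-shift (0≤r ⊕ ℤ.≤-reflexive (sym x≡)) (solve (D ∷ˡ k ∷ˡ r ∷ˡ x ∷ˡ []ˡ)) ,
      ≤-shift (r<D ⊕ ℤ.≤-reflexive x≡ ⊕ 0≤1) (solve (D ∷ˡ k ∷ˡ r ∷ˡ x ∷ˡ []ˡ))
    go : ∃[ k ] ∃[ r ] (x ≡ k ℤ.* + suc d ℤ.+ r × 0ℤ ℤ.≤ r × r ℤ.+ 1ℤ ℤ.≤ + suc d) → Clear (+ suc d) m x
    go (k , r , x≡ , 0≤r , r<D) =
      clear (+ suc d) k (near⁺ k (proj₁ bounds)) (near⁻ (k ℤ.+ 1ℤ) (proj₂ bounds))
      where bounds = floor-bounds {+ suc d} {k} {r} x≡ 0≤r r<D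

  -- Loneliness as a function on ℚ, and its maximum.

  lonelinessℚ : ∀ {n} → Vec ℕ (suc n) → ℚ → ℚ
  lonelinessℚ vs t = foldr₁ _⊓_ (Vec.map (λ v → ‖ + v / 1 * t ‖ℚ) vs)

  seq-loneliness : ∀ {n} (vs : Vec ℕ (suc n)) t k → seq (loneliness vs t) k ≡ lonelinessℚ vs (seq t k)
  seq-loneliness (v ∷ []) t k = refl
  seq-loneliness (v ∷ vs@(_ ∷ _)) t k = cong (‖ + v / 1 * seq t k ‖ℚ ⊓_) (seq-loneliness vs t k)

  speeds : ∀ {n} → Vec ℕ n → List ℤ
  speeds vs = List.map +_ (toList vs)

  All⇒≤lonelinessℚ : ∀ {n ρ t} (vs : Vec ℕ (suc n)) →
    All (λ v → ρ ≤ ‖ + v / 1 * t ‖ℚ) (toList vs) → ρ ≤ lonelinessℚ vs t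
  All⇒≤lonelinessℚ (v ∷ []) (far ∷ []) = far
  All⇒≤lonelinessℚ (v ∷ vs@(_ ∷ _)) (far ∷ fars) = ⊓-glb far (All⇒≤lonelinessℚ vs fars)

  ≤lonelinessℚ⇒All : ∀ {n ρ t} (vs : Vec ℕ (suc n)) →
    ρ ≤ lonelinessℚ vs t → All (λ v → ρ ≤ ‖ + v / 1 * t ‖ℚ) (toList vs)
  ≤lonelinessℚ⇒All (v ∷ []) far = far ∷ []
  ≤lonelinessℚ⇒All {t = t} (v ∷ vs@(_ ∷ _)) far =
    ≤-trans far (p⊓q≤p ‖ + v / 1 * t ‖ℚ (lonelinessℚ vs t)) ∷
    ≤lonelinessℚ⇒All vs (≤-trans far (p⊓q≤q ‖ + v / 1 * t ‖ℚ (lonelinessℚ vs t)))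

  lonely⇒≤lonelinessℚ : ∀ {n} (vs : Vec ℕ (suc n)) d m p → Lonely (+ suc d) m p (speeds vs) →
                        m / suc d ≤ lonelinessℚ vs (p / suc d)
  lonely⇒≤lonelinessℚ vs d m p lonely = All⇒≤lonelinessℚ vs (All.map
    (λ {v} clear → subst (λ x → m / suc d ≤ ‖ x ‖ℚ) (sym (integer-*-/ (+ v) p d)) (clear⇒≤‖‖ d m clear))
    (map⁻ lonely))

  ≤lonelinessℚ⇒lonely : ∀ {n} (vs : Vec ℕ (suc n)) d m p → m / suc d ≤ lonelinessℚ vs (p / suc d) →
                        Lonely (+ suc d) m p (speeds vs)
  ≤lonelinessℚ⇒lonely vs d m p far = map⁺ (All.map
    (λ {v} far → ≤‖‖⇒clear d m (subst (λ x → m / suc d ≤ ‖ x ‖ℚ) (integer-*-/ (+ v) p d) far))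
    (≤lonelinessℚ⇒All vs far))

  0≤lonelinessℚ : ∀ {n} (vs : Vec ℕ (suc n)) t → 0ℚ ≤ lonelinessℚ vs t
  0≤lonelinessℚ vs t = All⇒≤lonelinessℚ vs (All.universal (λ v → 0≤∣p∣ _) (toList vs))

  -- Writing t and its loneliness over one denominator makes the loneliness itself an m/D to which
  -- `Bounded` applies.
  bounded⇒lonelinessℚ≤ : ∀ {k} (vs : Vec ℕ (suc k)) n s → Bounded (+ suc n) s (speeds vs) →
                         ∀ t → lonelinessℚ vs t ≤ s / suc n
  bounded⇒lonelinessℚ≤ vs n s bounded t = go (common-denominator t (lonelinessℚ vs t))
    where
    go : ∃[ d ] ∃[ p ] ∃[ m ] (t ≡ p / suc d × lonelinessℚ vs t ≡ m / suc d) →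
         lonelinessℚ vs t ≤ s / suc n
    go (d , p , m , t≡ , ρ≡) = subst (_≤ s / suc n) (sym ρ≡) (/-mono-≤ m d s n
      (bounded (ℤ.+<+ (ℕ.s≤s ℕ.z≤n)) 0≤m (≤lonelinessℚ⇒lonely vs d m p
        (≤-reflexive (trans (sym ρ≡) (cong (lonelinessℚ vs) t≡))))))
      where
      0≤m : 0ℤ ℤ.≤ m
      0≤m = subst (0ℤ ℤ.≤_) (ℤ.*-identityʳ m)
        (/-cancel-≤ 0ℤ 0 m d (subst (0ℚ ≤_) ρ≡ (0≤lonelinessℚ vs t)))

  attains⇒≤lonelinessℚ : ∀ {k} (vs : Vec ℕ (suc k)) n s → Attains (+ suc n) s (speeds vs) →
                         ∃[ t ] s / suc n ≤ lonelinessℚ vs t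
  attains⇒≤lonelinessℚ vs n s (ℤ.+0 , _ , _ , ℤ.+<+ () , _)
  attains⇒≤lonelinessℚ vs n s (ℤ.+[1+ d ] , m , p , _ , sD≤mN , lonely) =
    p / suc d , ≤-trans (/-mono-≤ s n m d sD≤mN) (lonely⇒≤lonelinessℚ vs d m p lonely)

  p≤p+ε : ∀ p {ε} → 0ℚ < ε → p ≤ p + ε
  p≤p+ε p {ε} 0<ε = subst (_≤ p + ε) (+-identityʳ p) (+-monoʳ-≤ p (<⇒≤ 0<ε))

  -- A maximum over ℚ is one over ℝ: loneliness of a real time is computed termwise, so the bound
  -- holds at every approximant.
  maximum⇒isML : ∀ {n} (vs : Vec ℕ (suc n)) t ρ → lonelinessℚ vs t ≡ ρ →
                 (∀ q → lonelinessℚ vs q ≤ ρ) →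
                 IsML vs (fromℚ ρ)
  maximum⇒isML vs t ρ attained bound =
    (fromℚ t , λ ε 0<ε → 0 , λ n _ → subst (_≤ ε) (sym (zero-distance n)) (<⇒≤ 0<ε)) ,
    λ x ε 0<ε → 0 , λ n _ → ≤-trans
      (subst (_≤ ρ) (sym (seq-loneliness vs x n)) (bound (seq x n))) (p≤p+ε ρ 0<ε)
    where
    zero-distance : ∀ n → ∣ seq (loneliness vs (fromℚ t)) n - ρ ∣ ≡ 0ℚ
    zero-distance n = cong ∣_∣ (trans
      (cong (_- ρ) (trans (seq-loneliness vs (fromℚ t) n) attained)) (+-inverseʳ ρ))

  exact⇒isML : ∀ {k} (vs : Vec ℕ (suc k)) n s → Attains (+ suc n) s (speeds vs) →
               Bounded (+ suc n) s (speeds vs) → IsML vs (fromℚ (s / suc n))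
  exact⇒isML vs n s attains bounded with attains⇒≤lonelinessℚ vs n s attains
  ... | t , s/n≤ = maximum⇒isML vs t (s / suc n) (≤-antisym (bound t) s/n≤) bound
    where bound = bounded⇒lonelinessℚ≤ vs n s bounded

  -- The fractions l/(u + v) in [0, 1); the form `suc (ℕ.pred ...)` keeps the denominator visibly
  -- nonzero and equals u + v for positive speeds.
  candidates : List ℕ → List ℚ
  candidates vs = concatMap
    (λ (u , v) → List.map (λ l → + l / suc (ℕ.pred (u ℕ.+ v))) (upTo (u ℕ.+ v)))
    (cartesianProduct vs vs)

  dominated : ∀ {n} (vs : Vec ℕ (suc n)) → All (0ℤ ℤ.<_) (speeds vs) → ∀ t →
              ∃[ c ] (c ∈ candidates (toList vs) × lonelinessℚ vs t ≤ lonelinessℚ vs c)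
  dominated vs@(_ ∷ _) 0<vs t = go (common-denominator t (lonelinessℚ vs t))
    where
    Goal : ℚ → Set
    Goal ρ = ∃[ c ] (c ∈ candidates (toList vs) × ρ ≤ lonelinessℚ vs c)
    reduced : ∀ {d m u v A} → u ∈ toList vs → v ∈ toList vs → 0ℤ ℤ.< + u →
              m ℤ.* (+ u ℤ.+ + v) ℤ.≤ A ℤ.* + suc d →
              ∃[ l ] (+ l ℤ.< + (u ℕ.+ v) × Lonely (+ (u ℕ.+ v)) A (+ l) (speeds vs)) →
              Goal (m / suc d)
    reduced {u = zero} _ _ (ℤ.+<+ ()) _ _
    reduced {d} {m} {suc u} {v} {A} u∈ v∈ _ mN≤AD (l , ℤ.+<+ l<N , lonely) =
      + l / suc (u ℕ.+ v) ,
      ∈-concatMap⁺ _ (lose (∈-cartesianProduct⁺ u∈ v∈)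
        (∈-map⁺ (λ l → + l / suc (u ℕ.+ v)) (∈-upTo⁺ l<N))) ,
      ≤-trans (/-mono-≤ m d A (u ℕ.+ v) mN≤AD) (lonely⇒≤lonelinessℚ vs (u ℕ.+ v) A (+ l) lonely)
    locate : ∀ {d m} → ∃[ u ] ∃[ v ] ∃[ A ] ∃[ L ]
             (u ∈ speeds vs × v ∈ speeds vs ×
              m ℤ.* (u ℤ.+ v) ℤ.≤ A ℤ.* + suc d × Lonely (u ℤ.+ v) A L (speeds vs)) →
             Goal (m / suc d)
    locate {d} {m} (_ , _ , A , L , u∈ , v∈ , mN≤AD , lonely)
      with ∈-map⁻ +_ u∈ | ∈-map⁻ +_ v∈
    ... | u , u∈′ , refl | v , v∈′ , refl =
      reduced {d} {m} {u} {v} {A} u∈′ v∈′ 0<u mN≤AD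
        (lonely-mod {+ (u ℕ.+ v)} {A} {L} (ℤ.+-mono-<-≤ 0<u (ℤ.+≤+ (ℕ.z≤n {v}))) lonely)
      where
      0<u : 0ℤ ℤ.< + u
      0<u = All.lookup 0<vs u∈
    go : ∃[ d ] ∃[ p ] ∃[ m ] (t ≡ p / suc d × lonelinessℚ vs t ≡ m / suc d) → Goal (lonelinessℚ vs t)
    go (d , p , m , t≡ , ρ≡) = subst Goal (sym ρ≡) (locate {d} {m} (critical 0<vs (here refl)
      (≤lonelinessℚ⇒lonely vs d m p (≤-reflexive (trans (sym ρ≡) (cong (lonelinessℚ vs) t≡))))))

  maximum-exists : ∀ {n} (vs : Vec ℕ (suc n)) → All (0ℤ ℤ.<_) (speeds vs) →
                   ∃[ t ] (∀ q → lonelinessℚ vs q ≤ lonelinessℚ vs t)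
  -- The default time `0ℚ` does no harm: the result only has to dominate every candidate.
  maximum-exists vs 0<vs = argmax (lonelinessℚ vs) 0ℚ (candidates (toList vs)) , λ q →
    let c , c∈ , q≤c = dominated vs 0<vs q in
    ≤-trans q≤c (All.lookup (f[xs]≤f[argmax] {f = lonelinessℚ vs} 0ℚ (candidates (toList vs))) c∈)

  -- The spectra for two and three speeds.

  *+1 : ∀ k s → + k ℤ.* + s ℤ.+ 1ℤ ≡ + suc (k ℕ.* s)
  *+1 k s = trans (cong (ℤ._+ 1ℤ) (sym (ℤ.pos-* k s))) (cong +_ (ℕ.+-comm (k ℕ.* s) 1))

  family⇒isML : ∀ {n} (vs : Vec ℕ (suc n)) k s → Attains (+ k ℤ.* + s ℤ.+ 1ℤ) (+ s) (speeds vs) →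
                Bounded (+ k ℤ.* + s ℤ.+ 1ℤ) (+ s) (speeds vs) → IsML vs (fromℚ (+ s / suc (k ℕ.* s)))
  family⇒isML vs k s attains bounded = exact⇒isML vs (k ℕ.* s) (+ s)
    (subst (λ N → Attains N (+ s) (speeds vs)) (*+1 k s) attains)
    (subst (λ N → Bounded N (+ s) (speeds vs)) (*+1 k s) bounded)

  0<+ : ∀ v .{{_ : ℕ.NonZero v}} → 0ℤ ℤ.< + v
  0<+ v = ℤ.+<+ (ℕ.>-nonZero⁻¹ v)

  pair-spectrum : ∀ v₁ v₂ .{{_ : ℕ.NonZero v₁}} .{{_ : ℕ.NonZero v₂}} →
    (∃[ s ] (1 ℕ.≤ s × IsML (v₁ ∷ v₂ ∷ []) (fromℚ (+ s / suc (2 ℕ.* s)))))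
    ⊎ IsML (v₁ ∷ v₂ ∷ []) (fromℚ ½)
  pair-spectrum v₁ v₂ with pair-outcome (0<+ v₁) (0<+ v₂)
  ... | odd (+ s) (ℤ.+≤+ 1≤s) attains bounded =
    inj₁ (s , 1≤s , family⇒isML (v₁ ∷ v₂ ∷ []) 2 s attains bounded)
  ... | even attains bounded = inj₂ (exact⇒isML (v₁ ∷ v₂ ∷ []) 1 1ℤ attains bounded)

  triple-spectrum : ∀ v₁ v₂ v₃ .{{_ : ℕ.NonZero v₁}} .{{_ : ℕ.NonZero v₂}} .{{_ : ℕ.NonZero v₃}} →
    (∃[ s ] (1 ℕ.≤ s × IsML (v₁ ∷ v₂ ∷ v₃ ∷ []) (fromℚ (+ s / suc (3 ℕ.* s)))))
    ⊎ (∃[ m ] (IsML (v₁ ∷ v₂ ∷ v₃ ∷ []) m × fromℚ (+ 1 / 3) ≤ᴿ m))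
  triple-spectrum v₁ v₂ v₃ = go (triple-outcome (0<+ v₁) (0<+ v₂) (0<+ v₃))
    where
    vs = v₁ ∷ v₂ ∷ v₃ ∷ []
    go : Outcome (speeds vs) →
      (∃[ s ] (1 ℕ.≤ s × IsML vs (fromℚ (+ s / suc (3 ℕ.* s)))))
      ⊎ (∃[ m ] (IsML vs m × fromℚ (+ 1 / 3) ≤ᴿ m))
    go (exact (+ s) (ℤ.+≤+ 1≤s) attains bounded) = inj₁ (s , 1≤s , family⇒isML vs 3 s attains bounded)
    go (large attains) =
      let t , bound = maximum-exists vs (0<+ v₁ ∷ 0<+ v₂ ∷ 0<+ v₃ ∷ [])
          u , third≤ = attains⇒≤lonelinessℚ vs 2 1ℤ attains
          m = lonelinessℚ vs t
      in inj₂ (fromℚ m , maximum⇒isML vs t m refl bound ,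
        λ ε 0<ε → 0 , λ _ _ → ≤-trans third≤ (≤-trans (bound u) (p≤p+ε m 0<ε)))

open import Data.Integer using (+_)
open import Data.Nat using (ℕ; suc; _*_; _≤_; NonZero)
open import Data.Product using (_×_; _,_; ∃-syntax)
open import Data.Rational using (_/_; ½)
open import Data.Sum using (_⊎_)
open import Data.Vec using ([]; _∷_)

theorem2p1 : (∀ v₁ v₂ .{{_ : NonZero v₁}} .{{_ : NonZero v₂}} →
    (∃[ s ] (1 ≤ s × IsML (v₁ ∷ v₂ ∷ []) (fromℚ (+ s / suc (2 * s)))))
    ⊎ IsML (v₁ ∷ v₂ ∷ []) (fromℚ ½))
    ×
    (∀ v₁ v₂ v₃ .{{_ : NonZero v₁}} .{{_ : NonZero v₂}} .{{_ : NonZero v₃}} →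
    (∃[ s ] (1 ≤ s × IsML (v₁ ∷ v₂ ∷ v₃ ∷ []) (fromℚ (+ s / suc (3 * s)))))
    ⊎ (∃[ m ] (IsML (v₁ ∷ v₂ ∷ v₃ ∷ []) m × fromℚ (+ 1 / 3) ≤ᴿ m)))
theorem2p1 = Rational.pair-spectrum , Rational.triple-spectrum
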